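{- Let $(a,b,c)$ be a primitive positive definite binary quadratic form of discriminant $\Delta<0$ and let $p$ be any prime. Then $$w\sum_{(A,B,C)\in\Psi_p(a,b,c)}(A,B,C,q)=\left[p-\left(\tfrac{\Delta}{p}\right)\right](a,b,c,q^{p^2})+(a,b,c,q)-P_{p,0}(a,b,c,q),$$ where $w=3$ if $\Delta=-3$, $w=2$ if $\Delta=-4$, and $w=1$ if $\Delta<-4$.
   Context: $(a,b,c)$ denotes the $SL(2,\mathbb{Z})$-equivalence class of $ax^2+bxy+cy^2$, with $a>0$; primitive means $\gcd(a,b,c)=1$; discriminant $\Delta=b^2-4ac$. $\Psi_p(a,b,c)$ is the set of distinct primitive classes occurring in the list $\{(a,bp,cp^2)\}\cup\{(ap^2,pb+2ahp,ah^2+bh+c):0\le h<p\}$ of forms of discriminant $\Delta p^2$. The theta series is $(a,b,c,q):=\sum_{(x,y)\in\mathbb{Z}^2}q^{ax^2+bxy+cy^2}$. For $0\le r<m$, $P_{m,r}\sum_{n\ge0}a(n)q^n=\sum_{n\ge0}a(mn+r)q^{mn+r}$. $\left(\tfrac{\Delta}{p}\right)$ is the Legendre symbol for odd $p$ and the Kronecker symbol for $p=2$ ($0$ if $\Delta$ even, $1$ if $\Delta\equiv1\pmod8$, $-1$ if $\Delta\equiv5\pmod8$). -}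

module Defs where

open import Data.Nat as ℕ using (ℕ; zero; suc; NonZero)
open import Data.Nat.Divisibility using (_∣_; _∣?_; divides)
open import Data.Nat.GCD using (gcd)
open import Data.Integer as ℤ using (ℤ; +_; ∣_∣; _*_; _+_; _-_; -_)
open import Data.Integer.DivMod using (_%ℕ_)
open import Data.Product using (Σ; _×_; _,_; ∃)
open import Data.List using (List; []; _∷_; length; map; upTo)
open import Data.Bool.ListAction using (any)
open import Data.List.Membership.Propositional using (_∈_)
open import Data.List.Relation.Unary.Unique.Propositional using (Unique)
open import Data.List.Relation.Unary.AllPairs using (AllPairs)
open import Data.Bool using (Bool; true; false; if_then_else_)
open import Relation.Nullary using (¬_; yes; no; does)
open import Relation.Binary.PropositionalEquality using (_≡_)
open import Function.Bundles using (_⇔_)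

record Form : Set where
  constructor form
  field
    a b c : ℤ
open Form public

disc : Form → ℤ
disc (form a b c) = b * b - (+ 4) * a * c

eval : Form → ℤ × ℤ → ℤ
eval (form a b c) (x , y) = a * x * x + b * x * y + c * y * y

Primitive : Form → Set
Primitive (form a b c) = gcd (gcd ∣ a ∣ ∣ b ∣) ∣ c ∣ ≡ 1

PosDef : Form → Set
PosDef Q = (+ 0 ℤ.< a Q) × (disc Q ℤ.< + 0)

-- Q transformed by the matrix (α β ; γ δ): Q(αx+βy, γx+δy)
act : Form → ℤ → ℤ → ℤ → ℤ → Form
act (form a b c) α β γ δ =
  form (a * α * α + b * α * γ + c * γ * γ)
       ((+ 2) * a * α * β + b * (α * δ + β * γ) + (+ 2) * c * γ * δ)
       (a * β * β + b * β * δ + c * δ * δ)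

_~_ : Form → Form → Set
P ~ Q = Σ ℤ λ α → Σ ℤ λ β → Σ ℤ λ γ → Σ ℤ λ δ →
        (α * δ - β * γ ≡ + 1) × (act P α β γ δ ≡ Q)

-- The list of p+1 forms of discriminant Δp² from which Ψ_p(a,b,c) is extracted.
psiList : Form → ℕ → List Form
psiList (form a b c) p =
  form a (b * + p) (c * + p * + p) ∷
  map (λ h → form (a * + p * + p)
                  (+ p * b + (+ 2) * a * + h * + p)
                  (a * + h * + h + b * + h + c))
      (upTo p)

-- S is a list of representatives of Ψ_p(a,b,c): the distinct primitive
-- SL(2,ℤ)-classes occurring in psiList F p, each exactly once.
IsPsiReps : Form → ℕ → List Form → Set
IsPsiReps F p S =
  (∀ {Q} → Q ∈ S → Σ Form λ Q' → (Q' ∈ psiList F p) × Primitive Q' × (Q ~ Q')) ×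
  (∀ {Q'} → Q' ∈ psiList F p → Primitive Q' → Σ Form λ Q → (Q ∈ S) × (Q ~ Q')) ×
  AllPairs (λ Q R → ¬ (Q ~ R)) S

IsRepCount : Form → ℕ → ℕ → Set
IsRepCount Q n k =
  Σ (List (ℤ × ℤ)) λ l → Unique l × (∀ xy → (xy ∈ l) ⇔ (eval Q xy ≡ + n)) × (length l ≡ k)

-- coefficient of q^n in f(q^k), f given by its coefficient function
dilate : ℕ → (ℕ → ℕ) → ℕ → ℕ
dilate k f n with k ∣? n
... | yes (divides m _) = f m
... | no _ = 0

P0 : ℕ → (ℕ → ℕ) → ℕ → ℕ
P0 m f n = if does (m ∣? n) then f n else 0

symb : ℤ → ℕ → ℤ
symb Δ 2 with Δ %ℕ 8
... | 1 = + 1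
... | 5 = - (+ 1)
... | _ = + 0
symb Δ p =
  if does (p ∣? ∣ Δ ∣) then + 0
  else (if any (λ x → does (p ∣? ∣ + x * + x - Δ ∣)) (upTo p) then + 1 else - (+ 1))

wOf : ℤ → ℕ
wOf Δ = if does (Δ ℤ.≟ - (+ 3)) then 3 else (if does (Δ ℤ.≟ - (+ 4)) then 2 else 1)

{-# OPTIONS --safe #-}
module Submission where

-- The p + 1 forms of psiList are the restrictions of F to the sublattices of index p in ℤ², one for each
-- line of (ℤ/p)², and such a restriction is primitive exactly when F does not vanish on the line. Vectors
-- of pℤ² lie in all of these sublattices and any other vector in exactly one, which is primitive iff p does
-- not divide its value. As F has 1 + (Δ/p) isotropic lines, the restrictions to the anisotropic lines
-- together represent n exactly (right-hand side) times.
-- If p does not divide the value on the line, pℤ² is the set of vectors of the sublattice whose value is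
-- divisible by p, so that an equivalence between two primitive restrictions extends to a proper automorph
-- of F. Modulo ±1 there are w of these, α + uT, and they move an anisotropic line to w different
-- lines since det (α v + u T v , α′ v + u′ T v) = (α u′ − u α′) F(v). So each class occurs w times.

open import Defs
import Algebra.Properties.CommutativeSemigroup as CommutativeSemigroupProperties
open import Data.Bool using (Bool; true; false; T; if_then_else_)
open import Data.Bool.ListAction using (any)
open import Data.Bool.Properties using (T-≡)
open import Data.Integer as ℤ using (ℤ; +_; -[1+_]; _+_; _*_; _-_; -_; ∣_∣; NonZero)
open import Data.Integer.Divisibility.Signed as ∣ using (_∣_; divides; _∣?_; ∣⇒∣ᵤ; ∣ᵤ⇒∣; ∣m∣n⇒∣m+n; ∣m∣n⇒∣m-n; ∣n⇒∣m*n; ∣m⇒∣m*n; ∣m⇒∣-m; ∣m+n∣m⇒∣n; ∣m+n∣n⇒∣m)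
open import Data.Integer.DivMod using (_%ℕ_; _/ℕ_; n%ℕd<d; a≡a%ℕn+[a/ℕn]*n)
import Data.Integer.Properties as ℤ
open import Data.Integer.Tactic.RingSolver using (solve-∀)
open import Data.List using (List; []; _∷_; _++_; length; map; filter; upTo)
open import Data.List.Membership.Propositional using (_∈_; lose; find)
open import Data.List.Membership.Propositional.Properties using (∈-filter⁺; ∈-filter⁻; ∈-map⁺; ∈-map⁻; ∈-++⁺ˡ; ∈-++⁺ʳ; ∈-++⁻; ∈-upTo⁺; ∈-upTo⁻)
open import Data.List.Membership.Propositional.Properties.WithK using (unique∧set⇒bag)
open import Data.List.Properties using (length-map; length-upTo; map-++; map-∘; map-cong; filter-accept; filter-reject; filter-all; filter-none)
open import Data.List.Relation.Binary.BagAndSetEquality using (∼bag⇒↭)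
open import Data.List.Relation.Binary.Permutation.Propositional using (_↭_)
import Data.List.Relation.Binary.Permutation.Propositional.Properties as ↭
open import Data.List.Relation.Unary.All as All using (All; []; _∷_)
open import Data.List.Relation.Unary.AllPairs as AllPairs using (AllPairs; []; _∷_)
import Data.List.Relation.Unary.AllPairs.Properties as AllPairs
open import Data.List.Relation.Unary.Any as Any using (Any; here; there)
open import Data.List.Relation.Unary.Any.Properties using (any⁺; any⁻)
open import Data.List.Relation.Unary.Unique.Propositional using (Unique)
import Data.List.Relation.Unary.Unique.Propositional.Properties as Unique
open import Data.Maybe using (Maybe; just; nothing)
open import Data.Maybe.Properties using (just-injective)
open import Data.Nat as ℕ using (ℕ; zero; suc)
open import Data.Nat.Coprimality using (Coprime; coprime-Bézout; coprime-divisor) renaming (sym to coprime-sym)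
import Data.Nat.Divisibility as ℕ
open import Data.Nat.GCD using (module Bézout; gcd; gcd[m,n]∣m; gcd[m,n]∣n; gcd-greatest; c*gcd[m,n]≡gcd[cm,cn])
open import Data.Nat.ListAction using (sum)
open import Data.Nat.ListAction.Properties using (sum-↭; sum-++)
open import Data.Nat.Primality using (Prime; ¬prime[0]; ¬prime[1]; euclidsLemma; prime⇒irreducible; prime⇒nonZero; prime⇒nonTrivial)
import Data.Nat.Properties as ℕ
open import Data.Product using (Σ; ∃; _×_; _,_; proj₁; proj₂)
open import Data.Sum using (_⊎_; inj₁; inj₂; [_,_]′)
open import Function.Base using (_∘_)
open import Function.Bundles using (_⇔_; mk⇔; Equivalence)
open import Relation.Binary.PropositionalEquality using (_≡_; _≢_; refl; sym; trans; cong; cong₂; subst; module ≡-Reasoning)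
open import Relation.Nullary using (¬_; Dec; yes; no; does; contradiction)
open import Relation.Nullary.Decidable using (¬?; _×-dec_; dec-true; dec-false; from-no)
open import Relation.Unary using (Decidable)
open Equivalence using (to; from)

-- Finite sums and counting

-- The identity is proved coefficient by coefficient, counting pairs of an anisotropic line and a
-- vector of value n on it. If p divides n, only the vectors of pℤ² contribute and the last two
-- terms of the right-hand side cancel; otherwise each vector contributes once and the dilated term
-- vanishes. The obstacle in extending an equivalence to ℤ² is that the inverse of a sublattice
-- matrix has denominator p. Adjugates replace inverses: the conjugated matrix X is integral and
-- turns F into p²F, and what remains to be shown is that p divides X. The matrices α + uT form the
-- order of discriminant Δ and multiply F by their norm, so the proper automorphs are the 2w roots
-- of unity of that order. Representatives modulo ±1 have pairwise determinants αu′ - uα′ equal to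
-- ±1, not merely nonzero. This keeps the w images of a line distinct for every p, also for 2 and 3.
-- Equivalence of forms is never decided: the lines belonging to a class are handed over as an
-- explicit list.

unique-⇔⇒↭ : {A : Set} {xs ys : List A} → Unique xs → Unique ys →
             (∀ x → x ∈ xs ⇔ x ∈ ys) → xs ↭ ys
unique-⇔⇒↭ uxs uys xs⇔ys = ∼bag⇒↭ (unique∧set⇒bag uxs uys (λ {x} → xs⇔ys x))

unique-⇔⇒length≡ : {A : Set} {xs ys : List A} → Unique xs → Unique ys →
                   (∀ x → x ∈ xs ⇔ x ∈ ys) → length xs ≡ length ys
unique-⇔⇒length≡ uxs uys xs⇔ys = ↭.↭-length (unique-⇔⇒↭ uxs uys xs⇔ys)

-- Serves to compare representation counts: `f` will be multiplication by a matrix of nonzero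
-- determinant.
injection-length : {A B : Set} {xs : List A} {ys : List B} (f : A → B) →
                   (∀ {x x′} → f x ≡ f x′ → x ≡ x′) → Unique xs → Unique ys →
                   (∀ x → x ∈ xs → f x ∈ ys) → (∀ y → y ∈ ys → ∃ λ x → x ∈ xs × f x ≡ y) →
                   length xs ≡ length ys
injection-length {xs = xs} {ys} f inj uxs uys into onto =
  trans (sym (length-map f xs))
        (unique-⇔⇒length≡ (Unique.map⁺ inj uxs) uys λ y → mk⇔ (toʳ y) (fromʳ y))
  where
  toʳ : ∀ y → y ∈ map f xs → y ∈ ys
  toʳ y y∈ with x , x∈ , refl ← ∈-map⁻ f y∈ = into x x∈
  fromʳ : ∀ y → y ∈ ys → y ∈ map f xs
  fromʳ y y∈ with x , x∈ , refl ← onto y y∈ = ∈-map⁺ f x∈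

sum-map-const : {A : Set} {f : A → ℕ} {k : ℕ} (xs : List A) →
                (∀ {x} → x ∈ xs → f x ≡ k) → sum (map f xs) ≡ length xs ℕ.* k
sum-map-const []       eq = refl
sum-map-const (x ∷ xs) eq = cong₂ ℕ._+_ (eq (here refl)) (sum-map-const xs (eq ∘ there))

sum-map-cong∈ : {A : Set} {f g : A → ℕ} (xs : List A) →
                (∀ {x} → x ∈ xs → f x ≡ g x) → sum (map f xs) ≡ sum (map g xs)
sum-map-cong∈ []       eq = refl
sum-map-cong∈ (x ∷ xs) eq = cong₂ ℕ._+_ (eq (here refl)) (sum-map-cong∈ xs (eq ∘ there))

module _ {A B : Set} {P : A → B → Set} (P? : ∀ a → Decidable (P a)) where

  private
    cons-step : ∀ a b as bs → let k = length (filter (λ a → P? a b) as) in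
      k ℕ.+ sum (map (λ b → length (filter (λ a → P? a b) (a ∷ as))) bs)
        ≡ length (filter (P? a) bs) ℕ.+ (k ℕ.+ sum (map (λ b → length (filter (λ a → P? a b) as)) bs))
    cons-column : ∀ a as bs →
      sum (map (λ b → length (filter (λ a → P? a b) (a ∷ as))) bs)
        ≡ length (filter (P? a) bs) ℕ.+ sum (map (λ b → length (filter (λ a → P? a b) as)) bs)
    cons-column a as []       = refl
    cons-column a as (b ∷ bs) with does (P? a b)
    ... | true  = cong suc (cons-step a b as bs)
    ... | false = cons-step a b as bs

    cons-step a b as bs =
      trans (cong (k ℕ.+_) (cons-column a as bs)) (CommutativeSemigroupProperties.x∙yz≈y∙xz ℕ.+-commutativeSemigroup k (length (filter (P? a) bs)) _)
      where k = length (filter (λ a → P? a b) as)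

  double-count : ∀ as bs →
    sum (map (λ a → length (filter (P? a) bs)) as)
      ≡ sum (map (λ b → length (filter (λ a → P? a b) as)) bs)
  double-count []       bs = sym (trans (sum-map-const bs (λ _ → refl)) (ℕ.*-zeroʳ (length bs)))
  double-count (a ∷ as) bs =
    trans (cong (length (filter (P? a) bs) ℕ.+_) (double-count as bs)) (sym (cons-column a as bs))

module _ {A B : Set} (_≈_ : A → B → Set) (bs : List B) where

  -- A list with a characterisation and not a `filter`, because `≈` will be proper equivalence, for
  -- which no decision is at hand.
  Fibre : A → ℕ → Set
  Fibre a w = Σ (List B) λ ks → Unique ks × (∀ b → b ∈ ks ⇔ (b ∈ bs × a ≈ b)) × length ks ≡ w

  private
    union : ∀ {w} {f : A → ℕ} {g : B → ℕ} (as : List A) → (∀ {a} → a ∈ as → Fibre a w) →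
      AllPairs (λ a a′ → ∀ b → a ≈ b → ¬ a′ ≈ b) as →
      (∀ {a b} → a ∈ as → b ∈ bs → a ≈ b → f a ≡ g b) →
      Σ (List B) λ ks → Unique ks × (∀ b → b ∈ ks ⇔ (b ∈ bs × Any (_≈ b) as)) ×
        sum (map g ks) ≡ w ℕ.* sum (map f as)
    union {w} [] _ _ _ = [] , [] , (λ b → mk⇔ (λ ()) (λ { (_ , ()) })) , sym (ℕ.*-zeroʳ w)
    union {w} {f} {g} (a ∷ as) fib (a# ∷ dis) f≡g
      with ks , uks , ks⇔ , refl ← fib (here refl)
         | ls , uls , ls⇔ , eq ← union as (fib ∘ there) dis (λ a∈ → f≡g (there a∈)) =
      ks ++ ls , Unique.++⁺ uks uls (λ { (b∈ks , b∈ls) →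
          clash a# (proj₂ (to (ks⇔ _) b∈ks)) (proj₂ (to (ls⇔ _) b∈ls)) })
      , (λ b → mk⇔ (split b) (λ { (b∈ , here a≈b) → ∈-++⁺ˡ (from (ks⇔ b) (b∈ , a≈b))
                                 ; (b∈ , there as≈b) → ∈-++⁺ʳ ks (from (ls⇔ b) (b∈ , as≈b)) }))
      , (begin
          sum (map g (ks ++ ls))               ≡⟨ cong sum (map-++ g ks ls) ⟩
          sum (map g ks ++ map g ls)           ≡⟨ sum-++ (map g ks) (map g ls) ⟩
          sum (map g ks) ℕ.+ sum (map g ls)    ≡⟨ cong₂ ℕ._+_ (sum-map-const ks λ b∈ → let b∈bs , a≈b = to (ks⇔ _) b∈ in sym (f≡g (here refl) b∈bs a≈b)) eq ⟩
          w ℕ.* f a ℕ.+ w ℕ.* sum (map f as)   ≡⟨ ℕ.*-distribˡ-+ w (f a) _ ⟨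
          w ℕ.* (f a ℕ.+ sum (map f as))       ∎)
      where
      open ≡-Reasoning
      clash : ∀ {as b} → All (λ a′ → ∀ b → a ≈ b → ¬ a′ ≈ b) as → a ≈ b → ¬ Any (_≈ b) as
      clash (p ∷ ps) a≈b (here a′≈b)  = p _ a≈b a′≈b
      clash (p ∷ ps) a≈b (there a′≈b) = clash ps a≈b a′≈b
      split : ∀ b → b ∈ ks ++ ls → b ∈ bs × Any (_≈ b) (a ∷ as)
      split b b∈ with ∈-++⁻ ks b∈
      ... | inj₁ b∈ks = proj₁ (to (ks⇔ b) b∈ks) , here (proj₂ (to (ks⇔ b) b∈ks))
      ... | inj₂ b∈ls = proj₁ (to (ls⇔ b) b∈ls) , there (proj₂ (to (ls⇔ b) b∈ls))

  -- The concatenated fibres are a permutation of `bs`, and `g` is constant on each of them. It is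
  -- meant for class representatives `as` and anisotropic lines `bs`.
  sum-over-fibres : ∀ {w} {f : A → ℕ} {g : B → ℕ} (as : List A) → Unique bs →
    (∀ {a} → a ∈ as → Fibre a w) →
    AllPairs (λ a a′ → ∀ b → a ≈ b → ¬ a′ ≈ b) as →
    (∀ {b} → b ∈ bs → Any (_≈ b) as) →
    (∀ {a b} → a ∈ as → b ∈ bs → a ≈ b → f a ≡ g b) →
    w ℕ.* sum (map f as) ≡ sum (map g bs)
  sum-over-fibres {w} {f} {g} as ubs fibre disjoint cover f≡g
    with ks , uks , ks⇔ , eq ← union as fibre disjoint f≡g =
    trans (sym eq) (sum-↭ (↭.map⁺ g (unique-⇔⇒↭ uks ubs λ b →
      mk⇔ (proj₁ ∘ to (ks⇔ b)) (λ b∈ → from (ks⇔ b) (b∈ , cover b∈)))))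

-- Matrices acting on vectors and on forms

record Mat : Set where
  constructor mat
  field m₁₁ m₁₂ m₂₁ m₂₂ : ℤ

infixl 8 _⊗_ _⊙_
infixl 7 _⟨_⟩

_⊗_ : Mat → Mat → Mat
mat α β γ δ ⊗ mat x y z w = mat (α * x + β * z) (α * y + β * w) (γ * x + δ * z) (γ * y + δ * w)

_⊙_ : Mat → ℤ × ℤ → ℤ × ℤ
mat α β γ δ ⊙ (x , y) = α * x + β * y , γ * x + δ * y

det : Mat → ℤ
det (mat α β γ δ) = α * δ - β * γ

adj : Mat → Mat
adj (mat α β γ δ) = mat δ (- β) (- γ) α

scalar : ℤ → Mat
scalar k = mat k (+ 0) (+ 0) k

_⟨_⟩ : Form → Mat → Form
F ⟨ mat α β γ δ ⟩ = act F α β γ δ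

cross : ℤ × ℤ → ℤ × ℤ → ℤ
cross (x , y) (z , w) = x * w - y * z

form-≡ : ∀ {a b c a′ b′ c′} → a ≡ a′ → b ≡ b′ → c ≡ c′ → form a b c ≡ form a′ b′ c′
form-≡ refl refl refl = refl

mat-≡ : ∀ {a b c d a′ b′ c′ d′} → a ≡ a′ → b ≡ b′ → c ≡ c′ → d ≡ d′ → mat a b c d ≡ mat a′ b′ c′ d′
mat-≡ refl refl refl refl = refl

eval-⟨⟩ : ∀ F A v → eval (F ⟨ A ⟩) v ≡ eval F (A ⊙ v)
eval-⟨⟩ (form a b c) (mat α β γ δ) (x , y) = identity a b c α β γ δ x y
  where
  identity : ∀ a b c α β γ δ x z →
    (a * α * α + b * α * γ + c * γ * γ) * x * x
    + (+ 2 * a * α * β + b * (α * δ + β * γ) + + 2 * c * γ * δ) * x * z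
    + (a * β * β + b * β * δ + c * δ * δ) * z * z
    ≡ a * (α * x + β * z) * (α * x + β * z) + b * (α * x + β * z) * (γ * x + δ * z)
      + c * (γ * x + δ * z) * (γ * x + δ * z)
  identity = solve-∀

-- The outer coefficients of a transformed form are values at the columns of the matrix, so only the
-- middle one needs an identity of its own.
⟨⟩-⊗ : ∀ F A B → F ⟨ A ⟩ ⟨ B ⟩ ≡ F ⟨ A ⊗ B ⟩
⟨⟩-⊗ F@(form a b c) A@(mat α β γ δ) (mat x y z w) =
  form-≡ (eval-⟨⟩ F A (x , z)) (middle a b c α β γ δ x y z w) (eval-⟨⟩ F A (y , w))
  where
  middle : ∀ a b c α β γ δ x y z w →
    + 2 * (a * α * α + b * α * γ + c * γ * γ) * x * y
    + (+ 2 * a * α * β + b * (α * δ + β * γ) + + 2 * c * γ * δ) * (x * w + y * z)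
    + + 2 * (a * β * β + b * β * δ + c * δ * δ) * z * w
    ≡ + 2 * a * (α * x + β * z) * (α * y + β * w)
      + b * ((α * x + β * z) * (γ * y + δ * w) + (α * y + β * w) * (γ * x + δ * z))
      + + 2 * c * (γ * x + δ * z) * (γ * y + δ * w)
  middle = solve-∀

disc-⟨⟩ : ∀ F A → disc (F ⟨ A ⟩) ≡ det A * det A * disc F
disc-⟨⟩ (form a b c) (mat α β γ δ) = identity a b c α β γ δ
  where
  identity : ∀ a b c α β γ δ →
    (+ 2 * a * α * β + b * (α * δ + β * γ) + + 2 * c * γ * δ)
    * (+ 2 * a * α * β + b * (α * δ + β * γ) + + 2 * c * γ * δ)
    - + 4 * (a * α * α + b * α * γ + c * γ * γ) * (a * β * β + b * β * δ + c * δ * δ)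
    ≡ (α * δ - β * γ) * (α * δ - β * γ) * (b * b - + 4 * a * c)
  identity = solve-∀

det-⊗ : ∀ A B → det (A ⊗ B) ≡ det A * det B
det-⊗ (mat α β γ δ) (mat x y z w) = identity α β γ δ x y z w
  where
  identity : ∀ α β γ δ x y z w →
    (α * x + β * z) * (γ * y + δ * w) - (α * y + β * w) * (γ * x + δ * z)
    ≡ (α * δ - β * γ) * (x * w - y * z)
  identity = solve-∀

det-adj : ∀ A → det (adj A) ≡ det A
det-adj (mat α β γ δ) = identity α β γ δ
  where
  identity : ∀ α β γ δ → δ * α - - β * - γ ≡ α * δ - β * γ
  identity = solve-∀

adjʳ : ∀ A → A ⊗ adj A ≡ scalar (det A)
adjʳ (mat α β γ δ) = mat-≡ (e₁ α β γ δ) (e₂ α β) (e₃ γ δ) (e₄ α β γ δ)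
  where
  e₁ : ∀ α β γ δ → α * δ + β * - γ ≡ α * δ - β * γ
  e₁ = solve-∀
  e₂ : ∀ α β → α * - β + β * α ≡ + 0
  e₂ = solve-∀
  e₃ : ∀ γ δ → γ * δ + δ * - γ ≡ + 0
  e₃ = solve-∀
  e₄ : ∀ α β γ δ → γ * - β + δ * α ≡ α * δ - β * γ
  e₄ = solve-∀

adjˡ : ∀ A → adj A ⊗ A ≡ scalar (det A)
adjˡ (mat α β γ δ) = mat-≡ (e₁ α β γ δ) (e₂ β δ) (e₃ α γ) (e₄ α β γ δ)
  where
  e₁ : ∀ α β γ δ → δ * α + - β * γ ≡ α * δ - β * γ
  e₁ = solve-∀
  e₂ : ∀ β δ → δ * β + - β * δ ≡ + 0
  e₂ = solve-∀
  e₃ : ∀ α γ → - γ * α + α * γ ≡ + 0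
  e₃ = solve-∀
  e₄ : ∀ α β γ δ → - γ * β + α * δ ≡ α * δ - β * γ
  e₄ = solve-∀

⊙-⊗ : ∀ A B v → A ⊗ B ⊙ v ≡ A ⊙ (B ⊙ v)
⊙-⊗ (mat α β γ δ) (mat x y z w) (s , t) = cong₂ _,_ (row α β x y z w s t) (row γ δ x y z w s t)
  where
  row : ∀ α β x y z w s t → (α * x + β * z) * s + (α * y + β * w) * t ≡ α * (x * s + y * t) + β * (z * s + w * t)
  row = solve-∀

⊗-assoc : ∀ A B C → A ⊗ B ⊗ C ≡ A ⊗ (B ⊗ C)
⊗-assoc A B (mat x y z w) = mat-≡ (cong proj₁ left) (cong proj₁ right) (cong proj₂ left) (cong proj₂ right)
  where
  left  = ⊙-⊗ A B (x , z)
  right = ⊙-⊗ A B (y , w)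

⊗-scalar : ∀ A k → A ⊗ scalar k ≡ scalar k ⊗ A
⊗-scalar (mat α β γ δ) k = mat-≡ (e₁ α β γ k) (e₂ α β δ k) (e₃ γ δ α k) (e₄ γ δ β k)
  where
  e₁ : ∀ α β γ k → α * k + β * + 0 ≡ k * α + + 0 * γ
  e₁ = solve-∀
  e₂ : ∀ α β δ k → α * + 0 + β * k ≡ k * β + + 0 * δ
  e₂ = solve-∀
  e₃ : ∀ γ δ α k → γ * k + δ * + 0 ≡ + 0 * α + k * γ
  e₃ = solve-∀
  e₄ : ∀ γ δ β k → γ * + 0 + δ * k ≡ + 0 * β + k * δ
  e₄ = solve-∀

scalar⊙ : ∀ k x y → scalar k ⊙ (x , y) ≡ (k * x , k * y)
scalar⊙ k x y = cong₂ _,_ (e₁ k x y) (e₂ k x y)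
  where
  e₁ : ∀ k x y → k * x + + 0 * y ≡ k * x
  e₁ = solve-∀
  e₂ : ∀ k x y → + 0 * x + k * y ≡ k * y
  e₂ = solve-∀

scalar⊗ : ∀ k α β γ δ → scalar k ⊗ mat α β γ δ ≡ mat (k * α) (k * β) (k * γ) (k * δ)
scalar⊗ k α β γ δ = mat-≡ (e₁ k α γ) (e₁ k β δ) (e₂ k α γ) (e₂ k β δ)
  where
  e₁ : ∀ k x y → k * x + + 0 * y ≡ k * x
  e₁ = solve-∀
  e₂ : ∀ k x y → + 0 * x + k * y ≡ k * y
  e₂ = solve-∀

scalar⊗-cancel : ∀ k .{{_ : NonZero k}} A B → scalar k ⊗ A ≡ scalar k ⊗ B → A ≡ B
scalar⊗-cancel k A@(mat α β γ δ) B@(mat α′ β′ γ′ δ′) eq =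
  mat-≡ (cancel α α′ (cong Mat.m₁₁ eq′)) (cancel β β′ (cong Mat.m₁₂ eq′))
        (cancel γ γ′ (cong Mat.m₂₁ eq′)) (cancel δ δ′ (cong Mat.m₂₂ eq′))
  where
  eq′ = trans (sym (scalar⊗ k α β γ δ)) (trans eq (scalar⊗ k α′ β′ γ′ δ′))
  cancel : ∀ x y → k * x ≡ k * y → x ≡ y
  cancel x y = ℤ.*-cancelˡ-≡ k x y

⟨scalar⟩ : ∀ a b c k → form a b c ⟨ scalar k ⟩ ≡ form (k * k * a) (k * k * b) (k * k * c)
⟨scalar⟩ a b c k = form-≡ (e₁ a b c k) (e₂ a b c k) (e₃ a b c k)
  where
  e₁ : ∀ a b c k → a * k * k + b * k * + 0 + c * + 0 * + 0 ≡ k * k * a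
  e₁ = solve-∀
  e₂ : ∀ a b c k → + 2 * a * k * + 0 + b * (k * k + + 0 * + 0) + + 2 * c * + 0 * k ≡ k * k * b
  e₂ = solve-∀
  e₃ : ∀ a b c k → a * + 0 * + 0 + b * + 0 * k + c * k * k ≡ k * k * c
  e₃ = solve-∀

⟨scalar⟩-cancel : ∀ k .{{_ : NonZero k}} P Q → P ⟨ scalar k ⟩ ≡ Q ⟨ scalar k ⟩ → P ≡ Q
⟨scalar⟩-cancel k P@(form a b c) Q@(form a′ b′ c′) eq =
  form-≡ (cancel a a′ (cong Form.a eq′)) (cancel b b′ (cong Form.b eq′)) (cancel c c′ (cong Form.c eq′))
  where
  eq′ = trans (sym (⟨scalar⟩ a b c k)) (trans eq (⟨scalar⟩ a′ b′ c′ k))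
  cancel : ∀ x y → k * k * x ≡ k * k * y → x ≡ y
  cancel x y = ℤ.*-cancelˡ-≡ (k * k) x y {{ℤ.i*j≢0 k k}}

⟨1⟩ : ∀ F → F ⟨ scalar (+ 1) ⟩ ≡ F
⟨1⟩ (form a b c) = trans (⟨scalar⟩ a b c (+ 1)) (form-≡ (ℤ.*-identityˡ a) (ℤ.*-identityˡ b) (ℤ.*-identityˡ c))

1⊙ : ∀ v → scalar (+ 1) ⊙ v ≡ v
1⊙ (x , y) = trans (scalar⊙ (+ 1) x y) (cong₂ _,_ (ℤ.*-identityˡ x) (ℤ.*-identityˡ y))

eval-scalar : ∀ F k v → eval F (scalar k ⊙ v) ≡ k * k * eval F v
eval-scalar (form a b c) k (x , y) =
  trans (cong (eval (form a b c)) (scalar⊙ k x y)) (identity a b c k x y)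
  where
  identity : ∀ a b c k x y →
    a * (k * x) * (k * x) + b * (k * x) * (k * y) + c * (k * y) * (k * y) ≡ k * k * (a * x * x + b * x * y + c * y * y)
  identity = solve-∀

-- Multiplication by `adj A` leaves det A times each coordinate, which can be cancelled over ℤ even
-- if det A is p and not ±1.
⊙-injective : ∀ A .{{_ : NonZero (det A)}} {v w} → A ⊙ v ≡ A ⊙ w → v ≡ w
⊙-injective A {v@(x , y)} {w@(z , t)} eq =
  cong₂ _,_ (ℤ.*-cancelˡ-≡ (det A) x z (cong proj₁ eq′)) (ℤ.*-cancelˡ-≡ (det A) y t (cong proj₂ eq′))
  where
  open ≡-Reasoning
  eq′ : (det A * x , det A * y) ≡ (det A * z , det A * t)
  eq′ = begin
    (det A * x , det A * y)  ≡⟨ scalar⊙ (det A) x y ⟨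
    scalar (det A) ⊙ v       ≡⟨ cong (_⊙ v) (adjˡ A) ⟨
    adj A ⊗ A ⊙ v            ≡⟨ ⊙-⊗ (adj A) A v ⟩
    adj A ⊙ (A ⊙ v)          ≡⟨ cong (adj A ⊙_) eq ⟩
    adj A ⊙ (A ⊙ w)          ≡⟨ ⊙-⊗ (adj A) A w ⟨
    adj A ⊗ A ⊙ w            ≡⟨ cong (_⊙ w) (adjˡ A) ⟩
    scalar (det A) ⊙ w       ≡⟨ scalar⊙ (det A) z t ⟩
    (det A * z , det A * t)  ∎

-- Proper equivalence of forms

infix 4 _≋_

-- The relation `~` with its four integers packed into one matrix, so that symmetry and transitivity
-- become adjugate and product.
record _≋_ (P Q : Form) : Set where
  constructor equiv
  field
    change : Mat
    unimodular : det change ≡ + 1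
    carries : P ⟨ change ⟩ ≡ Q

~⇒≋ : ∀ {P Q} → P ~ Q → P ≋ Q
~⇒≋ (α , β , γ , δ , d , eq) = equiv (mat α β γ δ) d eq

≋⇒~ : ∀ {P Q} → P ≋ Q → P ~ Q
≋⇒~ (equiv (mat α β γ δ) d eq) = α , β , γ , δ , d , eq

≋-sym : ∀ {P Q} → P ≋ Q → Q ≋ P
≋-sym {P} (equiv M d refl) = equiv (adj M) (trans (det-adj M) d) (begin
  P ⟨ M ⟩ ⟨ adj M ⟩     ≡⟨ ⟨⟩-⊗ P M (adj M) ⟩
  P ⟨ M ⊗ adj M ⟩       ≡⟨ cong (P ⟨_⟩) (trans (adjʳ M) (cong scalar d)) ⟩
  P ⟨ scalar (+ 1) ⟩    ≡⟨ ⟨1⟩ P ⟩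
  P                     ∎)
  where open ≡-Reasoning

≋-trans : ∀ {P Q R} → P ≋ Q → Q ≋ R → P ≋ R
≋-trans {P} (equiv M d refl) (equiv N d′ refl) =
  equiv (M ⊗ N) (trans (det-⊗ M N) (cong₂ _*_ d d′)) (sym (⟨⟩-⊗ P M N))

rep-count-≋ : ∀ {P Q n k l} → P ≋ Q → IsRepCount P n k → IsRepCount Q n l → k ≡ l
rep-count-≋ {P} {n = n} (equiv M d refl) (xs , uxs , xs⇔ , refl) (ys , uys , ys⇔ , refl) =
  sym (injection-length (M ⊙_) (⊙-injective M {{subst NonZero (sym d) _}}) uys uxs
    (λ v v∈ → from (xs⇔ _) (trans (sym (eval-⟨⟩ P M v)) (to (ys⇔ v) v∈)))
    (λ v v∈ → adj M ⊙ v
            , from (ys⇔ _) (trans (eval-⟨⟩ P M _) (trans (cong (eval P) (cancel v)) (to (xs⇔ v) v∈)))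
            , cancel v))
  where
  open ≡-Reasoning
  cancel : ∀ v → M ⊙ (adj M ⊙ v) ≡ v
  cancel v = begin
    M ⊙ (adj M ⊙ v)    ≡⟨ ⊙-⊗ M (adj M) v ⟨
    M ⊗ adj M ⊙ v      ≡⟨ cong (_⊙ v) (trans (adjʳ M) (cong scalar d)) ⟩
    scalar (+ 1) ⊙ v   ≡⟨ 1⊙ v ⟩
    v                  ∎

-- Lines modulo p and sublattices of index p

∣-resp-≡ : ∀ {k x y} → x ≡ y → k ∣ x → k ∣ y
∣-resp-≡ refl k∣x = k∣x

-- Representatives of the points of the projective line over ℤ/p: `nothing` is the point at infinity
-- (1 : 0), and `just h` with h < p is (h : 1).
pt : Maybe ℕ → ℤ × ℤ
pt nothing  = + 1 , + 0
pt (just h) = + h , + 1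

lines : ℕ → List (Maybe ℕ)
lines p = nothing ∷ map just (upTo p)

-- The columns span the sublattice of the vectors that are multiples of pt i modulo p.
emb : ℕ → Maybe ℕ → Mat
emb p nothing  = mat (+ 1) (+ 0) (+ 0) (+ p)
emb p (just h) = mat (+ p) (+ h) (+ 0) (+ 1)

lines-unique : ∀ p → Unique (lines p)
lines-unique p = All.tabulate ∞∉ ∷ Unique.map⁺ just-injective (Unique.upTo⁺ p)
  where
  ∞∉ : ∀ {i} → i ∈ map just (upTo p) → nothing ≢ i
  ∞∉ i∈ refl with () ← proj₂ (proj₂ (∈-map⁻ just i∈))

just∈lines : ∀ {p h} → h ℕ.< p → just h ∈ lines p
just∈lines h<p = there (∈-map⁺ just (∈-upTo⁺ h<p))

just∈lines⁻ : ∀ {p h} → just h ∈ lines p → h ℕ.< p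
just∈lines⁻ (there i∈) with h , h∈ , refl ← ∈-map⁻ just i∈ = ∈-upTo⁻ h∈

psiList-emb : ∀ F p → psiList F p ≡ map (λ i → F ⟨ emb p i ⟩) (lines p)
psiList-emb (form a b c) p = cong₂ _∷_ (form-≡ (a₁ a b c) (b₁ a b c (+ p)) (c₁ a b c (+ p)))
  (trans (map-cong (λ h → form-≡ (a₂ a b c (+ p)) (b₂ a b c (+ p) (+ h)) (c₂ a b c (+ h))) (upTo p))
         (map-∘ (upTo p)))
  where
  a₁ : ∀ a b c → a ≡ a * + 1 * + 1 + b * + 1 * + 0 + c * + 0 * + 0
  a₁ = solve-∀
  b₁ : ∀ a b c p → b * p ≡ + 2 * a * + 1 * + 0 + b * (+ 1 * p + + 0 * + 0) + + 2 * c * + 0 * p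
  b₁ = solve-∀
  c₁ : ∀ a b c p → c * p * p ≡ a * + 0 * + 0 + b * + 0 * p + c * p * p
  c₁ = solve-∀
  a₂ : ∀ a b c p → a * p * p ≡ a * p * p + b * p * + 0 + c * + 0 * + 0
  a₂ = solve-∀
  b₂ : ∀ a b c p h → p * b + + 2 * a * h * p ≡ + 2 * a * p * h + b * (p * + 1 + h * + 0) + + 2 * c * + 0 * + 1
  b₂ = solve-∀
  c₂ : ∀ a b c h → a * h * h + b * h + c ≡ a * h * h + b * h * + 1 + c * + 1 * + 1
  c₂ = solve-∀

det-emb : ∀ p i → det (emb p i) ≡ + p
det-emb p nothing  = identity (+ p)
  where
  identity : ∀ p → + 1 * p - + 0 * + 0 ≡ p
  identity = solve-∀
det-emb p (just h) = identity (+ p) (+ h)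
  where
  identity : ∀ p h → p * + 1 - h * + 0 ≡ p
  identity = solve-∀

combine : ℤ → ℤ × ℤ → ℤ → ℤ × ℤ → ℤ × ℤ
combine s (x , y) t (z , w) = s * x + t * z , s * y + t * w

-- In the expansion of F(sv + kw) every term but s²F(v) carries a factor k. With k = p and v =
-- `pt i` this makes F on a line, modulo p, the constant F(`pt i`) times a square.
eval-combine : ∀ F s v k w → k ∣ eval F (combine s v k w) - s * s * eval F v
eval-combine (form a b c) s (x , y) k (z , w) = divides
  (s * (+ 2 * a * x * z + b * (x * w + y * z) + + 2 * c * y * w) + k * (a * z * z + b * z * w + c * w * w))
  (identity a b c s x y k z w)
  where
  identity : ∀ a b c s x y k z w →
    a * (s * x + k * z) * (s * x + k * z) + b * (s * x + k * z) * (s * y + k * w)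
    + c * (s * y + k * w) * (s * y + k * w) - s * s * (a * x * x + b * x * y + c * y * y)
    ≡ (s * (+ 2 * a * x * z + b * (x * w + y * z) + + 2 * c * y * w)
       + k * (a * z * z + b * z * w + c * w * w)) * k
  identity = solve-∀

⊙-combine : ∀ M s v t w → M ⊙ combine s v t w ≡ combine s (M ⊙ v) t (M ⊙ w)
⊙-combine (mat α β γ δ) s (x , y) t (z , w) = cong₂ _,_ (row α β s x y t z w) (row γ δ s x y t z w)
  where
  row : ∀ α β s x y t z w → α * (s * x + t * z) + β * (s * y + t * w) ≡ s * (α * x + β * y) + t * (α * z + β * w)
  row = solve-∀

cross-combine : ∀ s v t w u → cross (combine s v t w) u ≡ s * cross v u + t * cross w u
cross-combine s (x , y) t (z , w) (m , n) = identity s x y t z w m n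
  where
  identity : ∀ s x y t z w m n → (s * x + t * z) * n - (s * y + t * w) * m ≡ s * (x * n - y * m) + t * (z * n - w * m)
  identity = solve-∀

residue-unique : ∀ {p h k} → h ℕ.< p → k ℕ.< p → + p ∣ + h - + k → h ≡ k
residue-unique {p} {h} {k} h<p k<p p∣ = ℤ.+-injective (ℤ.i-j≡0⇒i≡j (+ h) (+ k)
  (ℤ.∣i∣≡0⇒i≡0 (small ∣ + h - + k ∣ bound (∣⇒∣ᵤ p∣))))
  where
  bound : ∣ + h - + k ∣ ℕ.< p
  bound = ℕ.≤-<-trans (subst (λ z → ∣ z ∣ ℕ.≤ h ℕ.⊔ k) (sym (ℤ.m-n≡m⊖n h k)) (ℤ.∣m⊝n∣≤m⊔n h k)) (ℕ.⊔-lub h<p k<p)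
  small : ∀ d → d ℕ.< p → p ℕ.∣ d → d ≡ 0
  small zero    _   _   = refl
  small (suc d) d<p p∣d = contradiction (ℕ.∣⇒≤ p∣d) (ℕ.<⇒≱ d<p)

module Modulo (p : ℕ) (pp : Prime p) where

  private instance
    p≢0 : ℕ.NonZero p
    p≢0 = prime⇒nonZero pp

  p∤1 : ¬ + p ∣ + 1
  p∤1 p∣1 = contradiction (ℕ.∣1⇒≡1 (∣⇒∣ᵤ p∣1)) (ℕ.nonTrivial⇒≢1 {{prime⇒nonTrivial pp}})

  euclid : ∀ x y → + p ∣ x * y → (+ p ∣ x) ⊎ (+ p ∣ y)
  euclid x y p∣xy with euclidsLemma ∣ x ∣ ∣ y ∣ pp (subst (p ℕ.∣_) (ℤ.abs-* x y) (∣⇒∣ᵤ p∣xy))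
  ... | inj₁ p∣x = inj₁ (∣ᵤ⇒∣ p∣x)
  ... | inj₂ p∣y = inj₂ (∣ᵤ⇒∣ p∣y)

  euclid-∤ˡ : ∀ x y → ¬ + p ∣ x → + p ∣ x * y → + p ∣ y
  euclid-∤ˡ x y p∤x p∣xy = [ (λ p∣x → contradiction p∣x p∤x) , (λ p∣y → p∣y) ]′ (euclid x y p∣xy)

  euclid-sq : ∀ x → + p ∣ x * x → + p ∣ x
  euclid-sq x p∣x² = [ (λ p∣x → p∣x) , (λ p∣x → p∣x) ]′ (euclid x x p∣x²)

  ∤-coprime : ∀ n → ¬ p ℕ.∣ n → Coprime p n
  ∤-coprime n p∤n (d∣p , d∣n) with prime⇒irreducible pp d∣p
  ... | inj₁ d≡1  = d≡1
  ... | inj₂ refl = contradiction d∣n p∤n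

  inverse : ∀ u → ¬ + p ∣ u → ∃ λ v → + p ∣ u * v - + 1
  inverse (+ n) p∤u with coprime-Bézout (∤-coprime n (p∤u ∘ ∣ᵤ⇒∣))
  ... | Bézout.+- x y eq = - + y , divides (- + x) (begin
    + n * - + y - + 1         ≡⟨ lhs (+ n) (+ y) ⟩
    - (+ 1 + + y * + n)       ≡⟨ cong (λ z → - (+ 1 + z)) (ℤ.pos-* y n) ⟨
    - + (1 ℕ.+ y ℕ.* n)       ≡⟨ cong (-_ ∘ +_) eq ⟩
    - + (x ℕ.* p)             ≡⟨ cong -_ (ℤ.pos-* x p) ⟩
    - (+ x * + p)             ≡⟨ ℤ.neg-distribˡ-* (+ x) (+ p) ⟩
    - + x * + p               ∎)
    where
    open ≡-Reasoning
    lhs : ∀ n y → n * - y - + 1 ≡ - (+ 1 + y * n)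
    lhs = solve-∀
  ... | Bézout.-+ x y eq = + y , divides (+ x) (begin
    + n * + y - + 1           ≡⟨ cong (_- + 1) (trans (ℤ.*-comm (+ n) (+ y)) (sym (ℤ.pos-* y n))) ⟩
    + (y ℕ.* n) - + 1         ≡⟨ cong (λ z → + z - + 1) eq ⟨
    + 1 + + (x ℕ.* p) - + 1   ≡⟨ cancel (+ (x ℕ.* p)) ⟩
    + (x ℕ.* p)               ≡⟨ ℤ.pos-* x p ⟩
    + x * + p                 ∎)
    where
    open ≡-Reasoning
    cancel : ∀ z → + 1 + z - + 1 ≡ z
    cancel = solve-∀
  inverse u@(-[1+ n ]) p∤u with v , p∣ ← inverse (+ suc n) (λ p∣n → p∤u (∣m⇒∣-m p∣n)) =
    - v , ∣-resp-≡ (identity (+ suc n) v) p∣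
    where
    identity : ∀ u v → u * v - + 1 ≡ - u * - v - + 1
    identity = solve-∀

  residue : ∀ t → ∃ λ h → h ℕ.< p × + p ∣ + h - t
  residue t = t %ℕ p , n%ℕd<d t p , divides (- (t /ℕ p)) (begin
    + (t %ℕ p) - t                                        ≡⟨ cong (_-_ (+ (t %ℕ p))) (a≡a%ℕn+[a/ℕn]*n t p) ⟩
    + (t %ℕ p) - (+ (t %ℕ p) + (t /ℕ p) * + p)            ≡⟨ cancel (+ (t %ℕ p)) (t /ℕ p) (+ p) ⟩
    - (t /ℕ p) * + p                                      ∎)
    where
    open ≡-Reasoning
    cancel : ∀ r q p → r - (r + q * p) ≡ - q * p
    cancel = solve-∀

  linear-root : ∀ u t → ¬ + p ∣ u → ∃ λ h → h ℕ.< p × + p ∣ u * + h - t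
  linear-root u t p∤u with v , p∣uv-1 ← inverse u p∤u with h , h<p , p∣h-vt ← residue (v * t) =
    h , h<p , ∣-resp-≡ (identity u v t (+ h)) (∣m∣n⇒∣m+n (∣n⇒∣m*n u p∣h-vt) (∣n⇒∣m*n t p∣uv-1))
    where
    identity : ∀ u v t h → u * (h - v * t) + t * (u * v - + 1) ≡ u * h - t
    identity = solve-∀

  linear-root-unique : ∀ u t {h k} → ¬ + p ∣ u → h ℕ.< p → k ℕ.< p →
                       + p ∣ u * + h - t → + p ∣ u * + k - t → h ≡ k
  linear-root-unique u t {h} {k} p∤u h<p k<p p∣h p∣k = residue-unique h<p k<p
    (euclid-∤ˡ u _ p∤u (∣-resp-≡ (identity u t (+ h) (+ k)) (∣m∣n⇒∣m-n p∣h p∣k)))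
    where
    identity : ∀ u t h k → u * h - t - (u * k - t) ≡ u * (h - k)
    identity = solve-∀

  -- The determinant vanishes modulo p exactly on the sublattice spanned by `emb p i`; all of pℤ²
  -- lies on every line.
  On : Maybe ℕ → ℤ × ℤ → Set
  On i v = + p ∣ cross v (pt i)

  On? : ∀ i v → Dec (On i v)
  On? i v = + p ∣? cross v (pt i)

  Multiple : ℤ × ℤ → Set
  Multiple (x , y) = (+ p ∣ x) × (+ p ∣ y)

  Multiple? : ∀ v → Dec (Multiple v)
  Multiple? (x , y) = (+ p ∣? x) ×-dec (+ p ∣? y)

  multiple⇒on : ∀ i v → Multiple v → On i v
  multiple⇒on i (x , y) (p∣x , p∣y) with pt i
  ... | z , w = ∣m∣n⇒∣m-n (∣m⇒∣m*n w p∣x) (∣m⇒∣m*n z p∣y)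

  multiple⇒scalar : ∀ v → Multiple v → ∃ λ u → scalar (+ p) ⊙ u ≡ v
  multiple⇒scalar v (divides s refl , divides t refl) =
    (s , t) , trans (scalar⊙ (+ p) s t) (cong₂ _,_ (ℤ.*-comm (+ p) s) (ℤ.*-comm (+ p) t))

  scalar⇒multiple : ∀ u → Multiple (scalar (+ p) ⊙ u)
  scalar⇒multiple (s , t) = subst Multiple (sym (scalar⊙ (+ p) s t))
    (divides s (ℤ.*-comm (+ p) s) , divides t (ℤ.*-comm (+ p) t))

  -- One coordinate with respect to the columns of `emb p i` is a coordinate of `v`; the other is,
  -- up to sign, the quotient of the determinant by p.
  on⇒emb : ∀ i v → On i v → ∃ λ u → emb p i ⊙ u ≡ v
  on⇒emb nothing (x , y) (divides q eq) = (x , - q) ,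
    cong₂ _,_ (id₁ x q) (trans (id₂ x q (+ p)) (trans (cong -_ (sym eq)) (id₃ x y)))
    where
    id₁ : ∀ x q → + 1 * x + + 0 * - q ≡ x
    id₁ = solve-∀
    id₂ : ∀ x q p → + 0 * x + p * - q ≡ - (q * p)
    id₂ = solve-∀
    id₃ : ∀ x y → - (x * + 0 - y * + 1) ≡ y
    id₃ = solve-∀
  on⇒emb (just h) (x , y) (divides q eq) = (q , y) ,
    cong₂ _,_ (trans (id₁ q y (+ p) (+ h)) (trans (cong (_+ y * + h) (sym eq)) (id₂ x y (+ h)))) (id₃ q y)
    where
    id₁ : ∀ q y p h → p * q + h * y ≡ q * p + y * h
    id₁ = solve-∀
    id₂ : ∀ x y h → x * + 1 - y * h + y * h ≡ x
    id₂ = solve-∀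
    id₃ : ∀ q y → + 0 * q + + 1 * y ≡ y
    id₃ = solve-∀

  emb⇒on : ∀ i u → On i (emb p i ⊙ u)
  emb⇒on nothing (x , y) = divides (- y) (identity x y (+ p))
    where
    identity : ∀ x y p → (+ 1 * x + + 0 * y) * + 0 - (+ 0 * x + p * y) * + 1 ≡ - y * p
    identity = solve-∀
  emb⇒on (just h) (x , y) = divides x (identity x y (+ p) (+ h))
    where
    identity : ∀ x y p h → (p * x + h * y) * + 1 - (+ 0 * x + + 1 * y) * h ≡ x * p
    identity = solve-∀

  -- Brings the vectors of the sublattice into the shape to which `eval-combine` and `cross-combine`
  -- apply.
  emb-combine : ∀ i u → ∃ λ t → ∃ λ w → emb p i ⊙ u ≡ combine t (pt i) (+ p) w
  emb-combine nothing (x , y) = x , (+ 0 , y) , cong₂ _,_ (id₁ x y (+ p)) (id₂ x y (+ p))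
    where
    id₁ : ∀ x y p → + 1 * x + + 0 * y ≡ x * + 1 + p * + 0
    id₁ = solve-∀
    id₂ : ∀ x y p → + 0 * x + p * y ≡ x * + 0 + p * y
    id₂ = solve-∀
  emb-combine (just h) (x , y) = y , (x , + 0) , cong₂ _,_ (id₁ x y (+ p) (+ h)) (id₂ x y (+ p))
    where
    id₁ : ∀ x y p h → p * x + h * y ≡ y * h + p * x
    id₁ = solve-∀
    id₂ : ∀ x y p → + 0 * x + + 1 * y ≡ y * + 1 + p * + 0
    id₂ = solve-∀

  on⇒combine : ∀ i v → On i v → ∃ λ t → ∃ λ w → v ≡ combine t (pt i) (+ p) w
  on⇒combine i v on with u , refl ← on⇒emb i v on = emb-combine i u

  on-zero : ∀ F i v → On i v → + p ∣ eval F (pt i) → + p ∣ eval F v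
  on-zero F i v on p∣ with t , w , refl ← on⇒combine i v on =
    ∣m+n∣n⇒∣m (eval-combine F t (pt i) (+ p) w) (∣m⇒∣-m (∣n⇒∣m*n (t * t) p∣))

  multiple-combine : ∀ {t} v w → + p ∣ t → Multiple (combine t v (+ p) w)
  multiple-combine (x , y) (z , w) p∣t =
    ∣m∣n⇒∣m+n (∣m⇒∣m*n x p∣t) (∣m⇒∣m*n z ∣.∣-refl) , ∣m∣n⇒∣m+n (∣m⇒∣m*n y p∣t) (∣m⇒∣m*n w ∣.∣-refl)

  -- The form restricted to an anisotropic line is, mod p, a nonzero multiple of a square.
  on-anisotropic : ∀ F i v → On i v → ¬ + p ∣ eval F (pt i) → + p ∣ eval F v → Multiple v
  on-anisotropic F i v on p∤ p∣Fv with t , w , refl ← on⇒combine i v on =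
    multiple-combine (pt i) w (euclid-sq t (euclid-∤ˡ _ (t * t) p∤ (∣-resp-≡ (ℤ.*-comm (t * t) _) p∣t²F)))
    where
    p∣t²F : + p ∣ t * t * eval F (pt i)
    p∣t²F = ∣-resp-≡ (identity (eval F (combine t (pt i) (+ p) w)) (t * t * eval F (pt i))) (∣m∣n⇒∣m-n p∣Fv (eval-combine F t (pt i) (+ p) w))
      where
      identity : ∀ x y → x - (x - y) ≡ y
      identity = solve-∀

  -- By linearity M(t `pt i` + p w) is t M(`pt i`) modulo p, so the image of one representative
  -- decides where the whole sublattice goes.
  on-image : ∀ M i j v → On j (M ⊙ pt i) → On i v → On j (M ⊙ v)
  on-image M i j v onM onv with t , w , refl ← on⇒combine i v onv =
    ∣-resp-≡ (sym (trans (cong (λ v → cross v (pt j)) (⊙-combine M t (pt i) (+ p) w))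
                         (cross-combine t (M ⊙ pt i) (+ p) (M ⊙ w) (pt j))))
             (∣m∣n⇒∣m+n (∣n⇒∣m*n t onM) (∣m⇒∣m*n _ ∣.∣-refl))

  line : ∀ v → ¬ Multiple v → ∃ λ i → i ∈ lines p × On i v
  line (x , y) ¬mul with + p ∣? y
  ... | yes p∣y = nothing , here refl , ∣m∣n⇒∣m-n (∣n⇒∣m*n x (divides (+ 0) refl)) (∣m⇒∣m*n (+ 1) p∣y)
  -- The line is that of the quotient x/y modulo p.
  ... | no  p∤y with h , h<p , p∣ ← linear-root y x p∤y =
    just h , just∈lines h<p , ∣-resp-≡ (identity x y (+ h)) (∣m⇒∣-m p∣)
    where
    identity : ∀ x y h → - (y * h - x) ≡ x * + 1 - y * h
    identity = solve-∀

  -- In v = t `pt j` + p w the factor t is prime to p, since `v` is not in pℤ²; hence t can be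
  -- cancelled from the determinant with `pt i`.
  on-common : ∀ i j v → On i v → On j v → ¬ Multiple v → + p ∣ cross (pt j) (pt i)
  on-common i j v oni onj ¬mul with t , w , refl ← on⇒combine j v onj =
    euclid-∤ˡ t _ (λ p∣t → ¬mul (multiple-combine (pt j) w p∣t))
      (∣m+n∣n⇒∣m (∣-resp-≡ (cross-combine t (pt j) (+ p) w (pt i)) oni) (∣m⇒∣m*n _ ∣.∣-refl))

  line-unique : ∀ {i j} v → i ∈ lines p → j ∈ lines p → ¬ Multiple v → On i v → On j v → i ≡ j
  line-unique {i} {j} v i∈ j∈ ¬mul oni onj = meet i j i∈ j∈ (on-common i j v oni onj ¬mul)
    where
    -- The determinant of two representatives is ±1 if just one of them is at infinity, and a
    -- difference of residues below p if neither is.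
    meet : ∀ i j → i ∈ lines p → j ∈ lines p → + p ∣ cross (pt j) (pt i) → i ≡ j
    meet nothing  nothing  _ _ _ = refl
    meet nothing  (just h) _ _ p∣ = contradiction (∣-resp-≡ (identity (+ h)) p∣) (p∤1 ∘ ∣m⇒∣-m)
      where
      identity : ∀ h → h * + 0 - + 1 * + 1 ≡ - + 1
      identity = solve-∀
    meet (just h) nothing  _ _ p∣ = contradiction (∣-resp-≡ (identity (+ h)) p∣) p∤1
      where
      identity : ∀ h → + 1 * + 1 - + 0 * h ≡ + 1
      identity = solve-∀
    meet (just h) (just k) i∈ j∈ p∣ = cong just (residue-unique (just∈lines⁻ i∈) (just∈lines⁻ j∈)
      (∣-resp-≡ (identity (+ h) (+ k)) (∣m⇒∣-m p∣)))
      where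
      identity : ∀ h k → - (k * + 1 - + 1 * h) ≡ h - k
      identity = solve-∀

-- Isometries between sublattices

columns : ℤ × ℤ → ℤ × ℤ → Mat
columns (x , z) (y , w) = mat x y z w

col₁ col₂ : Mat → ℤ × ℤ
col₁ (mat α β γ δ) = α , γ
col₂ (mat α β γ δ) = β , δ

col₁-⊗ : ∀ A B → col₁ (A ⊗ B) ≡ A ⊙ col₁ B
col₁-⊗ _ _ = refl

col₂-⊗ : ∀ A B → col₂ (A ⊗ B) ≡ A ⊙ col₂ B
col₂-⊗ _ _ = refl

eval-col₁ : ∀ F A → eval F (col₁ A) ≡ Form.a (F ⟨ A ⟩)
eval-col₁ _ _ = refl

eval-col₂ : ∀ F A → eval F (col₂ A) ≡ Form.c (F ⟨ A ⟩)
eval-col₂ _ _ = refl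

Automorph : Form → Mat → Set
Automorph F M = det M ≡ + 1 × F ⟨ M ⟩ ≡ F

eval-automorph : ∀ {F M} → Automorph F M → ∀ v → eval F (M ⊙ v) ≡ eval F v
eval-automorph {F} {M} (_ , FM≡F) v = trans (sym (eval-⟨⟩ F M v)) (cong (λ Q → eval Q v) FM≡F)

-- X = E′ N E⁻¹ scaled by det E, so that it has integer entries.
module _ (E E′ N X : Mat) (X≡ : X ≡ E′ ⊗ (N ⊗ adj E)) where
  open ≡-Reasoning

  -- As `adj E` is det E times the inverse of `E`, undoing `E` with it leaves the scalar det E, that
  -- is, F multiplied by (det E)².
  ⟨conjugate⟩ : ∀ F → F ⟨ E′ ⟩ ⟨ N ⟩ ≡ F ⟨ E ⟩ → F ⟨ X ⟩ ≡ F ⟨ scalar (det E) ⟩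
  ⟨conjugate⟩ F eq = begin
    F ⟨ X ⟩                     ≡⟨ cong (F ⟨_⟩) X≡ ⟩
    F ⟨ E′ ⊗ (N ⊗ adj E) ⟩      ≡⟨ ⟨⟩-⊗ F E′ (N ⊗ adj E) ⟨
    F ⟨ E′ ⟩ ⟨ N ⊗ adj E ⟩      ≡⟨ ⟨⟩-⊗ (F ⟨ E′ ⟩) N (adj E) ⟨
    F ⟨ E′ ⟩ ⟨ N ⟩ ⟨ adj E ⟩    ≡⟨ cong (_⟨ adj E ⟩) eq ⟩
    F ⟨ E ⟩ ⟨ adj E ⟩           ≡⟨ ⟨⟩-⊗ F E (adj E) ⟩
    F ⟨ E ⊗ adj E ⟩             ≡⟨ cong (F ⟨_⟩) (adjʳ E) ⟩
    F ⟨ scalar (det E) ⟩        ∎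

  module _ .{{_ : NonZero (det E)}} (M : Mat) (M≡ : scalar (det E) ⊗ M ≡ X) where

    -- This says that `M` extends `N`: it sends the vector with coordinates u in the first
    -- sublattice to the one with coordinates N u in the second.
    conjugate-⊗ : M ⊗ E ≡ E′ ⊗ N
    conjugate-⊗ = scalar⊗-cancel (det E) (M ⊗ E) (E′ ⊗ N) (begin
      scalar (det E) ⊗ (M ⊗ E)    ≡⟨ ⊗-assoc (scalar (det E)) M E ⟨
      scalar (det E) ⊗ M ⊗ E      ≡⟨ cong (_⊗ E) (trans M≡ X≡) ⟩
      E′ ⊗ (N ⊗ adj E) ⊗ E        ≡⟨ cong (_⊗ E) (⊗-assoc E′ N (adj E)) ⟨
      E′ ⊗ N ⊗ adj E ⊗ E          ≡⟨ ⊗-assoc (E′ ⊗ N) (adj E) E ⟩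
      E′ ⊗ N ⊗ (adj E ⊗ E)        ≡⟨ cong (E′ ⊗ N ⊗_) (adjˡ E) ⟩
      E′ ⊗ N ⊗ scalar (det E)     ≡⟨ ⊗-scalar (E′ ⊗ N) (det E) ⟩
      scalar (det E) ⊗ (E′ ⊗ N)   ∎)

    -- Both sublattices have the same index, so the determinant of `M` is read off `conjugate-⊗`;
    -- the form is recovered by cancelling (det E)² from `⟨conjugate⟩`.
    conjugate-automorph : ∀ F → F ⟨ E′ ⟩ ⟨ N ⟩ ≡ F ⟨ E ⟩ → det E′ ≡ det E → det N ≡ + 1 → Automorph F M
    conjugate-automorph F eq detE′ detN =
      ℤ.*-cancelʳ-≡ (det M) (+ 1) (det E) (begin
        det M * det E      ≡⟨ det-⊗ M E ⟨
        det (M ⊗ E)        ≡⟨ cong det conjugate-⊗ ⟩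
        det (E′ ⊗ N)       ≡⟨ det-⊗ E′ N ⟩
        det E′ * det N     ≡⟨ cong₂ _*_ detE′ detN ⟩
        det E * + 1        ≡⟨ ℤ.*-comm (det E) (+ 1) ⟩
        + 1 * det E        ∎) ,
      ⟨scalar⟩-cancel (det E) (F ⟨ M ⟩) F (begin
        F ⟨ M ⟩ ⟨ scalar (det E) ⟩    ≡⟨ ⟨⟩-⊗ F M (scalar (det E)) ⟩
        F ⟨ M ⊗ scalar (det E) ⟩      ≡⟨ cong (F ⟨_⟩) (trans (⊗-scalar M (det E)) M≡) ⟩
        F ⟨ X ⟩                       ≡⟨ ⟨conjugate⟩ F eq ⟩
        F ⟨ scalar (det E) ⟩          ∎)

module Lines (p : ℕ) (pp : Prime p) where
  open Modulo p pp

  private instance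
    +p≢0 : NonZero (+ p)
    +p≢0 = prime⇒nonZero pp

  p∣p²x : ∀ x → + p ∣ + p * + p * x
  p∣p²x x = ∣m⇒∣m*n x (∣m⇒∣m*n (+ p) ∣.∣-refl)

  columns-on : ∀ i v w → On i v → On i w → ∃ λ N → emb p i ⊗ N ≡ columns v w
  columns-on i v w onv onw with u , eq ← on⇒emb i v onv | u′ , eq′ ← on⇒emb i w onw =
    columns u u′ , cong₂ columns eq eq′

  pt-on : ∀ i → On i (pt i)
  pt-on i = divides (+ 0) (identity (proj₁ (pt i)) (proj₂ (pt i)))
    where
    identity : ∀ x y → x * y - y * x ≡ + 0
    identity = solve-∀

  -- Since `pt i` itself lies in the sublattice of `i`, its image under `A` can be read off the
  -- product of `A` with the sublattice matrix.
  pt-on-emb : ∀ i A B → A ⊗ emb p i ≡ B → ∃ λ e → A ⊙ pt i ≡ B ⊙ e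
  pt-on-emb i A B refl with e , eq ← on⇒emb i (pt i) (pt-on i) =
    e , trans (cong (A ⊙_) (sym eq)) (sym (⊙-⊗ A (emb p i) e))

  -- `M` carries a basis of the sublattice of `i` into that of `j`, so that M E = E′ N with an
  -- integral `N`. Both sublattices have index p, which forces det N = 1.
  automorph⇒≋ : ∀ {F M} i j → Automorph F M → On j (M ⊙ pt i) → F ⟨ emb p j ⟩ ≋ F ⟨ emb p i ⟩
  automorph⇒≋ {F} {M} i j (detM , FM≡F) on =
    equiv N det-N (begin
      F ⟨ E′ ⟩ ⟨ N ⟩    ≡⟨ ⟨⟩-⊗ F E′ N ⟩
      F ⟨ E′ ⊗ N ⟩      ≡⟨ cong (F ⟨_⟩) eq′ ⟩
      F ⟨ M ⊗ E ⟩       ≡⟨ ⟨⟩-⊗ F M E ⟨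
      F ⟨ M ⟩ ⟨ E ⟩     ≡⟨ cong (_⟨ E ⟩) FM≡F ⟩
      F ⟨ E ⟩           ∎)
    where
    open ≡-Reasoning
    E  = emb p i
    E′ = emb p j
    image : ∀ u → On j (M ⊙ (E ⊙ u))
    image u = on-image M i j (E ⊙ u) on (emb⇒on i u)
    factor : ∃ λ N → E′ ⊗ N ≡ columns (M ⊙ (E ⊙ (+ 1 , + 0))) (M ⊙ (E ⊙ (+ 0 , + 1)))
    factor = columns-on j _ _ (image (+ 1 , + 0)) (image (+ 0 , + 1))
    N = proj₁ factor
    columns-e : ∀ A → columns (A ⊙ (+ 1 , + 0)) (A ⊙ (+ 0 , + 1)) ≡ A
    columns-e (mat α β γ δ) = mat-≡ (e₁ α β) (e₂ α β) (e₁ γ δ) (e₂ γ δ)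
      where
      e₁ : ∀ x y → x * + 1 + y * + 0 ≡ x
      e₁ = solve-∀
      e₂ : ∀ x y → x * + 0 + y * + 1 ≡ y
      e₂ = solve-∀
    eq′ : E′ ⊗ N ≡ M ⊗ E
    eq′ = trans (proj₂ factor) (trans (sym (cong₂ columns (⊙-⊗ M E (+ 1 , + 0)) (⊙-⊗ M E (+ 0 , + 1)))) (columns-e (M ⊗ E)))
    det-N : det N ≡ + 1
    det-N = ℤ.*-cancelˡ-≡ (+ p) (det N) (+ 1) (begin
      + p * det N        ≡⟨ cong (_* det N) (det-emb p j) ⟨
      det E′ * det N     ≡⟨ det-⊗ E′ N ⟨
      det (E′ ⊗ N)       ≡⟨ cong det eq′ ⟩
      det (M ⊗ E)        ≡⟨ det-⊗ M E ⟩
      det M * det E      ≡⟨ cong₂ _*_ detM (det-emb p i) ⟩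
      + 1 * + p          ≡⟨ ℤ.*-comm (+ 1) (+ p) ⟩
      + p * + 1          ∎)

  -- The values of F at the columns of `X` are the outer coefficients p²a and p²c, so
  -- `on-anisotropic` puts each column into pℤ².
  scalar-factor : ∀ F j X → ¬ + p ∣ eval F (pt j) → On j (col₁ X) → On j (col₂ X) →
                  F ⟨ X ⟩ ≡ F ⟨ scalar (+ p) ⟩ → ∃ λ M → scalar (+ p) ⊗ M ≡ X
  scalar-factor F@(form a b c) j X p∤ on₁ on₂ FX =
    columns (proj₁ u) (proj₁ w) , cong₂ columns (proj₂ u) (proj₂ w)
    where
    FX′ : F ⟨ X ⟩ ≡ form (+ p * + p * a) (+ p * + p * b) (+ p * + p * c)
    FX′ = trans FX (⟨scalar⟩ a b c (+ p))
    factor : ∀ v x → On j v → eval F v ≡ + p * + p * x → ∃ λ u → scalar (+ p) ⊙ u ≡ v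
    factor v x on Fv = multiple⇒scalar v (on-anisotropic F j v on p∤ (∣-resp-≡ (sym Fv) (p∣p²x x)))
    u = factor (col₁ X) a on₁ (trans (eval-col₁ F X) (cong Form.a FX′))
    w = factor (col₂ X) c on₂ (trans (eval-col₂ F X) (cong Form.c FX′))

  -- The isometry N between the two restrictions extends to ℤ² because it maps pℤ², the set of
  -- vectors of the sublattice with value divisible by p, to itself.
  ≋⇒automorph : ∀ F i j → ¬ + p ∣ eval F (pt j) → F ⟨ emb p j ⟩ ≋ F ⟨ emb p i ⟩ →
                ∃ λ M → Automorph F M × On j (M ⊙ pt i)
  ≋⇒automorph F i j p∤ (equiv N detN eq) =
    extend F i j N (emb p i) (emb p j) (det-emb p i) (det-emb p j) refl refl p∤ detN eq
    where
    -- The sublattice matrices become variables here: only their determinants and the lines they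
    -- span enter the argument.
    extend : ∀ F i j N E E′ → det E ≡ + p → det E′ ≡ + p → E ≡ emb p i → E′ ≡ emb p j →
      ¬ + p ∣ eval F (pt j) → det N ≡ + 1 → F ⟨ E′ ⟩ ⟨ N ⟩ ≡ F ⟨ E ⟩ → ∃ λ M → Automorph F M × On j (M ⊙ pt i)
    extend F i j N E E′ detE detE′ E≡ E′≡ p∤ detN eq = conclude (E′ ⊗ (N ⊗ adj E)) refl
      where
      on-E′ : ∀ v u → v ≡ E′ ⊙ u → On j v
      on-E′ v u v≡ = subst (On j) (sym (trans v≡ (cong (_⊙ u) E′≡))) (emb⇒on j u)
      instance
        detE≢0 : NonZero (det E)
        detE≢0 = subst NonZero (sym detE) +p≢0
      close : ∀ X M → X ≡ E′ ⊗ (N ⊗ adj E) → scalar (det E) ⊗ M ≡ X →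
              (∃ λ e → M ⊙ pt i ≡ E′ ⊗ N ⊙ e) → ∃ λ M → Automorph F M × On j (M ⊙ pt i)
      close X M X≡ M≡ (e , Mpt≡) =
        M , conjugate-automorph E E′ N X X≡ M M≡ F eq (trans detE′ (sym detE)) detN
          , on-E′ (M ⊙ pt i) (N ⊙ e) (trans Mpt≡ (⊙-⊗ E′ N e))
      finish : ∀ X → X ≡ E′ ⊗ (N ⊗ adj E) → (∃ λ M → scalar (+ p) ⊗ M ≡ X) →
               ∃ λ M → Automorph F M × On j (M ⊙ pt i)
      finish X X≡ (M , M≡) =
        close X M X≡ M≡′ (pt-on-emb i M (E′ ⊗ N) (trans (cong (M ⊗_) (sym E≡)) (conjugate-⊗ E E′ N X X≡ M M≡′)))
        where M≡′ = trans (cong (λ k → scalar k ⊗ M) detE) M≡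
      factor : ∀ X → X ≡ E′ ⊗ (N ⊗ adj E) → ∃ λ M → scalar (+ p) ⊗ M ≡ X
      factor X X≡ = scalar-factor F j X p∤
        (on-E′ (col₁ X) (col₁ (N ⊗ adj E)) (trans (cong col₁ X≡) (col₁-⊗ E′ (N ⊗ adj E))))
        (on-E′ (col₂ X) (col₂ (N ⊗ adj E)) (trans (cong col₂ X≡) (col₂-⊗ E′ (N ⊗ adj E))))
        (trans (⟨conjugate⟩ E E′ N X X≡ F eq) (cong (λ k → F ⟨ scalar k ⟩) detE))
      conclude : ∀ X → X ≡ E′ ⊗ (N ⊗ adj E) → ∃ λ M → Automorph F M × On j (M ⊙ pt i)
      conclude X X≡ = finish X X≡ (factor X X≡)

-- Primitivity and positivity of restrictions

DividesForm : ℤ → Form → Set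
DividesForm d (form a b c) = (d ∣ a) × (d ∣ b) × (d ∣ c)

dividesForm-eval : ∀ {d} F v → DividesForm d F → d ∣ eval F v
dividesForm-eval (form a b c) (x , y) (d∣a , d∣b , d∣c) =
  ∣m∣n⇒∣m+n (∣m∣n⇒∣m+n (∣m⇒∣m*n x (∣m⇒∣m*n x d∣a)) (∣m⇒∣m*n y (∣m⇒∣m*n x d∣b))) (∣m⇒∣m*n y (∣m⇒∣m*n y d∣c))

dividesForm-⟨⟩ : ∀ {d} F A → DividesForm d F → DividesForm d (F ⟨ A ⟩)
dividesForm-⟨⟩ {d} (form a b c) (mat α β γ δ) (d∣a , d∣b , d∣c) =
  outer α γ ,
  ∣m∣n⇒∣m+n (∣m∣n⇒∣m+n (∣m⇒∣m*n β (∣m⇒∣m*n α (∣n⇒∣m*n (+ 2) d∣a))) (∣m⇒∣m*n (α * δ + β * γ) d∣b))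
            (∣m⇒∣m*n δ (∣m⇒∣m*n γ (∣n⇒∣m*n (+ 2) d∣c))) ,
  outer β δ
  where
  outer : ∀ x y → d ∣ a * x * x + b * x * y + c * y * y
  outer x y = dividesForm-eval (form a b c) (x , y) (d∣a , d∣b , d∣c)

-- Three values suffice, as b = F(1,1) - F(1,0) - F(0,1).
eval⇒dividesForm : ∀ {d} F → (∀ v → d ∣ eval F v) → DividesForm d F
eval⇒dividesForm (form a b c) d∣F =
  ∣-resp-≡ (e₁ a b c) (d∣F (+ 1 , + 0)) ,
  ∣-resp-≡ (e₂ a b c) (∣m∣n⇒∣m-n (d∣F (+ 1 , + 1)) (∣m∣n⇒∣m+n (d∣F (+ 1 , + 0)) (d∣F (+ 0 , + 1)))) ,
  ∣-resp-≡ (e₃ a b c) (d∣F (+ 0 , + 1))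
  where
  e₁ : ∀ a b c → a * + 1 * + 1 + b * + 1 * + 0 + c * + 0 * + 0 ≡ a
  e₁ = solve-∀
  e₂ : ∀ a b c → a * + 1 * + 1 + b * + 1 * + 1 + c * + 1 * + 1
    - (a * + 1 * + 1 + b * + 1 * + 0 + c * + 0 * + 0 + (a * + 0 * + 0 + b * + 0 * + 1 + c * + 1 * + 1)) ≡ b
  e₂ = solve-∀
  e₃ : ∀ a b c → a * + 0 * + 0 + b * + 0 * + 1 + c * + 1 * + 1 ≡ c
  e₃ = solve-∀

primitive⇒divisor≡1 : ∀ F {d} → Primitive F → DividesForm (+ d) F → d ≡ 1
primitive⇒divisor≡1 (form a b c) prim (d∣a , d∣b , d∣c) = ℕ.∣1⇒≡1 (subst (_ ℕ.∣_) prim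
  (gcd-greatest (gcd-greatest (∣⇒∣ᵤ d∣a) (∣⇒∣ᵤ d∣b)) (∣⇒∣ᵤ d∣c)))

divisor≡1⇒primitive : ∀ F → (∀ d → DividesForm (+ d) F → d ≡ 1) → Primitive F
divisor≡1⇒primitive (form a b c) divisor≡1 = divisor≡1 (gcd g ∣ c ∣)
  ( ∣ᵤ⇒∣ (ℕ.∣-trans (gcd[m,n]∣m g ∣ c ∣) (gcd[m,n]∣m ∣ a ∣ ∣ b ∣))
  , ∣ᵤ⇒∣ (ℕ.∣-trans (gcd[m,n]∣m g ∣ c ∣) (gcd[m,n]∣n ∣ a ∣ ∣ b ∣))
  , ∣ᵤ⇒∣ (gcd[m,n]∣n g ∣ c ∣))
  where g = gcd ∣ a ∣ ∣ b ∣

-- The gcd of az, bz and cz is |z|. The lemma will show that a divides the lower left entry of an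
-- automorph.
primitive-cancel : ∀ a b c → Primitive (form a b c) → ∀ {k} z → k ∣ a * z → k ∣ b * z → k ∣ c * z → k ∣ z
primitive-cancel a b c prim {k} z k∣az k∣bz k∣cz = ∣ᵤ⇒∣ (subst (∣ k ∣ ℕ.∣_) gcd≡z
  (gcd-greatest (gcd-greatest (flip a k∣az) (flip b k∣bz)) (flip c k∣cz)))
  where
  open ≡-Reasoning
  n = ∣ z ∣
  flip : ∀ x → k ∣ x * z → ∣ k ∣ ℕ.∣ n ℕ.* ∣ x ∣
  flip x k∣xz = subst (∣ k ∣ ℕ.∣_) (trans (ℤ.abs-* x z) (ℕ.*-comm ∣ x ∣ n)) (∣⇒∣ᵤ k∣xz)
  gcd≡z : gcd (gcd (n ℕ.* ∣ a ∣) (n ℕ.* ∣ b ∣)) (n ℕ.* ∣ c ∣) ≡ n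
  gcd≡z = begin
    gcd (gcd (n ℕ.* ∣ a ∣) (n ℕ.* ∣ b ∣)) (n ℕ.* ∣ c ∣)  ≡⟨ cong (λ g → gcd g (n ℕ.* ∣ c ∣)) (c*gcd[m,n]≡gcd[cm,cn] n ∣ a ∣ ∣ b ∣) ⟨
    gcd (n ℕ.* gcd ∣ a ∣ ∣ b ∣) (n ℕ.* ∣ c ∣)            ≡⟨ c*gcd[m,n]≡gcd[cm,cn] n (gcd ∣ a ∣ ∣ b ∣) ∣ c ∣ ⟨
    n ℕ.* gcd (gcd ∣ a ∣ ∣ b ∣) ∣ c ∣                    ≡⟨ cong (n ℕ.*_) prim ⟩
    n ℕ.* 1                                             ≡⟨ ℕ.*-identityʳ n ⟩
    n                                                   ∎

module Sublattice (p : ℕ) (pp : Prime p) where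
  open Modulo p pp
  open Lines p pp

  -- If p divides the value at `pt i`, it divides every value on the sublattice by `on-zero`, hence
  -- all coefficients of the restriction.
  primitive⇒anisotropic : ∀ F i → Primitive (F ⟨ emb p i ⟩) → ¬ + p ∣ eval F (pt i)
  primitive⇒anisotropic F i prim p∣ = p∤1 (subst (λ d → + p ∣ + d) p≡1 ∣.∣-refl)
    where
    p≡1 : p ≡ 1
    p≡1 = primitive⇒divisor≡1 (F ⟨ emb p i ⟩) prim (eval⇒dividesForm (F ⟨ emb p i ⟩) λ v →
      ∣-resp-≡ (sym (eval-⟨⟩ F (emb p i) v)) (on-zero F i (emb p i ⊙ v) (emb⇒on i v) p∣))

  coprime-cancel : ∀ d x → ¬ p ℕ.∣ d → + d ∣ + p * x → + d ∣ x
  coprime-cancel d x p∤d d∣px = ∣ᵤ⇒∣ (coprime-divisor (coprime-sym (∤-coprime d p∤d))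
    (subst (d ℕ.∣_) (ℤ.abs-* (+ p) x) (∣⇒∣ᵤ d∣px)))

  -- A common divisor d of the restriction divides its value at `pt i`, so it is prime to p.
  -- Transforming by the adjugate gives the form p²F, which d still divides; hence d divides F.
  anisotropic⇒primitive : ∀ F i → Primitive F → ¬ + p ∣ eval F (pt i) → Primitive (F ⟨ emb p i ⟩)
  anisotropic⇒primitive F@(form a b c) i prim p∤ = divisor≡1⇒primitive (F ⟨ emb p i ⟩) λ d d∣ →
    primitive⇒divisor≡1 F prim (descend d (p∤d d d∣) (d∣p²F d d∣))
    where
    p∤d : ∀ d → DividesForm (+ d) (F ⟨ emb p i ⟩) → ¬ p ℕ.∣ d
    p∤d d d∣ p∣d = p∤ (∣.∣-trans (∣ᵤ⇒∣ p∣d) d∣Fpt)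
      where
      u = on⇒emb i (pt i) (pt-on i)
      d∣Fpt : + d ∣ eval F (pt i)
      d∣Fpt = ∣-resp-≡ (trans (eval-⟨⟩ F (emb p i) (proj₁ u)) (cong (eval F) (proj₂ u)))
        (dividesForm-eval (F ⟨ emb p i ⟩) (proj₁ u) d∣)
    d∣p²F : ∀ d → DividesForm (+ d) (F ⟨ emb p i ⟩) → DividesForm (+ d) (form (+ p * + p * a) (+ p * + p * b) (+ p * + p * c))
    d∣p²F d d∣ = subst (DividesForm (+ d)) (trans (⟨⟩-⊗ F (emb p i) (adj (emb p i)))
        (trans (cong (F ⟨_⟩) (trans (adjʳ (emb p i)) (cong scalar (det-emb p i)))) (⟨scalar⟩ a b c (+ p))))
      (dividesForm-⟨⟩ (F ⟨ emb p i ⟩) (adj (emb p i)) d∣)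
    descend : ∀ d → ¬ p ℕ.∣ d → DividesForm (+ d) (form (+ p * + p * a) (+ p * + p * b) (+ p * + p * c)) → DividesForm (+ d) F
    descend d p∤d (d∣a , d∣b , d∣c) = cancel a d∣a , cancel b d∣b , cancel c d∣c
      where
      cancel : ∀ x → + d ∣ + p * + p * x → + d ∣ x
      cancel x d∣ = coprime-cancel d x p∤d (coprime-cancel d (+ p * x) p∤d (∣-resp-≡ (ℤ.*-assoc (+ p) (+ p) x) d∣))

square-pos : ∀ i → i * i ≡ + (∣ i ∣ ℕ.* ∣ i ∣)
square-pos (+ n)    = sym (ℤ.pos-* n n)
square-pos -[1+ n ] = refl

disc<0⇒a≢0 : ∀ b c → ¬ disc (form (+ 0) b c) ℤ.< + 0
disc<0⇒a≢0 b c disc<0 = ℤ.<⇒≱ disc<0 (subst (+ 0 ℤ.≤_) (sym (trans (identity b c) (square-pos b))) (ℤ.+≤+ ℕ.z≤n))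
  where
  identity : ∀ b c → b * b - + 4 * + 0 * c ≡ b * b
  identity = solve-∀

four-a-eval : ∀ F x y → + 4 * Form.a F * eval F (x , y) ≡
  (+ 2 * Form.a F * x + Form.b F * y) * (+ 2 * Form.a F * x + Form.b F * y) - disc F * (y * y)
four-a-eval (form a b c) x y = identity a b c x y
  where
  identity : ∀ a b c x y → + 4 * a * (a * x * x + b * x * y + c * y * y)
    ≡ (+ 2 * a * x + b * y) * (+ 2 * a * x + b * y) - (b * b - + 4 * a * c) * (y * y)
  identity = solve-∀

0≤square-neg*square : ∀ x Δ y → Δ ℤ.< + 0 → + 0 ℤ.≤ x * x - Δ * (y * y)
0≤square-neg*square x (-[1+ d ]) y _ = subst (+ 0 ℤ.≤_) (sym eq) (ℤ.+≤+ ℕ.z≤n)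
  where
  open ≡-Reasoning
  identity : ∀ x d y → x * x - - d * (y * y) ≡ x * x + d * (y * y)
  identity = solve-∀
  X = ∣ x ∣ ℕ.* ∣ x ∣
  Y = ∣ y ∣ ℕ.* ∣ y ∣
  eq : x * x - -[1+ d ] * (y * y) ≡ + (X ℕ.+ suc d ℕ.* Y)
  eq = begin
    x * x - -[1+ d ] * (y * y)    ≡⟨ identity x (+ suc d) y ⟩
    x * x + + suc d * (y * y)     ≡⟨ cong₂ (λ s t → s + + suc d * t) (square-pos x) (square-pos y) ⟩
    + X + + suc d * + Y           ≡⟨ cong (λ t → + X + t) (ℤ.pos-* (suc d) Y) ⟨
    + (X ℕ.+ suc d ℕ.* Y)         ∎
0≤square-neg*square x (+ d) y (ℤ.+<+ ())

-- The new leading coefficient n is a value of F, and completing the square gives 4an ≥ 0. It is not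
-- 0, because the new discriminant is still negative while a form without x² term has discriminant
-- b².
posDef-⟨⟩ : ∀ F A → .{{NonZero (det A)}} → PosDef F → PosDef (F ⟨ A ⟩)
posDef-⟨⟩ F A (0<a , Δ<0) = positive (Form.a F) (disc F) (Form.a Q) (+ 2 * Form.a F * proj₁ (col₁ A) + Form.b F * proj₂ (col₁ A)) (proj₂ (col₁ A)) 0<a Δ<0
    (trans (cong (λ n → + 4 * Form.a F * n) (sym (eval-col₁ F A))) (four-a-eval F (proj₁ (col₁ A)) (proj₂ (col₁ A))))
    (λ a≡0 → disc<0⇒a≢0 (Form.b Q) (Form.c Q) (subst (λ a → disc (form a (Form.b Q) (Form.c Q)) ℤ.< + 0) a≡0 Δ′<0))
  , Δ′<0
  where
  Q = F ⟨ A ⟩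
  square-neg : ∀ k Δ → .{{NonZero k}} → Δ ℤ.< + 0 → k * k * Δ ℤ.< + 0
  square-neg (+ suc k)  -[1+ d ] _ = ℤ.-<+
  square-neg (-[1+ k ]) -[1+ d ] _ = ℤ.-<+
  square-neg k (+ d) (ℤ.+<+ ())
  Δ′<0 : disc Q ℤ.< + 0
  Δ′<0 = subst (ℤ._< + 0) (sym (disc-⟨⟩ F A)) (square-neg (det A) (disc F) Δ<0)
  positive : ∀ a Δ n x y → + 0 ℤ.< a → Δ ℤ.< + 0 → + 4 * a * n ≡ x * x - Δ * (y * y) → n ≢ + 0 → + 0 ℤ.< n
  positive a Δ (+ zero)  x y _ _ _ n≢0 = contradiction refl n≢0
  positive a Δ (+ suc n) x y _ _ _ _ = ℤ.+<+ ℕ.z<s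
  positive (+ suc a) Δ -[1+ n ] x y _ Δ<0 eq _
    with () ← subst (+ 0 ℤ.≤_) (sym eq) (0≤square-neg*square x Δ y Δ<0)
  positive (+ zero) Δ -[1+ n ] x y (ℤ.+<+ ()) _ _ _

-- Proper automorphs

-- The norm of α + uT in the order ℤ[T], where T has trace b and determinant ac; as a form in α and
-- u it again has discriminant Δ.
norm : Form → ℤ × ℤ → ℤ
norm (form a b c) (α , u) = α * α + b * α * u + a * c * (u * u)

-- This is α + u T with T = (0 −c; a b), for which cross v (T v) = F(v).
unit : Form → ℤ × ℤ → Mat
unit (form a b c) (α , u) = mat α (- (c * u)) (a * u) (α + b * u)

-- Substituting α + uT multiplies each coefficient of F by the norm, for arbitrary α and u.
unit-automorph : ∀ F e → norm F e ≡ + 1 → Automorph F (unit F e)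
unit-automorph F@(form a b c) (α , u) n≡1 =
  trans (det≡ a b c α u) n≡1 ,
  form-≡ (trans (a≡ a b c α u) (times a)) (trans (b≡ a b c α u) (times b)) (trans (c≡ a b c α u) (times c))
  where
  n = norm F (α , u)
  times : ∀ x → n * x ≡ x
  times x = trans (cong (_* x) n≡1) (ℤ.*-identityˡ x)
  det≡ : ∀ a b c α u → α * (α + b * u) - - (c * u) * (a * u) ≡ α * α + b * α * u + a * c * (u * u)
  det≡ = solve-∀
  a≡ : ∀ a b c α u → a * α * α + b * α * (a * u) + c * (a * u) * (a * u) ≡ (α * α + b * α * u + a * c * (u * u)) * a
  a≡ = solve-∀
  b≡ : ∀ a b c α u → + 2 * a * α * - (c * u) + b * (α * (α + b * u) + - (c * u) * (a * u)) + + 2 * c * (a * u) * (α + b * u)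
    ≡ (α * α + b * α * u + a * c * (u * u)) * b
  b≡ = solve-∀
  c≡ : ∀ a b c α u → a * - (c * u) * - (c * u) + b * - (c * u) * (α + b * u) + c * (α + b * u) * (α + b * u)
    ≡ (α * α + b * α * u + a * c * (u * u)) * c
  c≡ = solve-∀

unit-cross : ∀ F α u α′ u′ v → cross (unit F (α , u) ⊙ v) (unit F (α′ , u′) ⊙ v) ≡ (α * u′ - u * α′) * eval F v
unit-cross (form a b c) α u α′ u′ (x , y) = identity a b c α u α′ u′ x y
  where
  identity : ∀ a b c α u α′ u′ x y →
    (α * x + - (c * u) * y) * (a * u′ * x + (α′ + b * u′) * y) - (a * u * x + (α + b * u) * y) * (α′ * x + - (c * u′) * y)
    ≡ (α * u′ - u * α′) * (a * x * x + b * x * y + c * y * y)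
  identity = solve-∀

-- A solution and its negative move a vector to the same line, which is why the units are needed
-- modulo ±1 only.
unit-neg-cross : ∀ F α u v w → cross (unit F (- α , - u) ⊙ v) w ≡ - cross (unit F (α , u) ⊙ v) w
unit-neg-cross (form a b c) α u (x , y) (z , w) = identity a b c α u x y z w
  where
  identity : ∀ a b c α u x y z w →
    (- α * x + - (c * - u) * y) * w - (a * - u * x + (- α + b * - u) * y) * z
    ≡ - ((α * x + - (c * u) * y) * w - (a * u * x + (α + b * u) * y) * z)
  identity = solve-∀

module _ {a b c α β γ δ : ℤ} (det≡1 : α * δ - β * γ ≡ + 1) (fixes : form a b c ⟨ mat α β γ δ ⟩ ≡ form a b c) where
  open ≡-Reasoning

  private
    F = form a b c
    A′ = Form.a (F ⟨ mat α β γ δ ⟩)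
    B′ = Form.b (F ⟨ mat α β γ δ ⟩)
    C′ = Form.c (F ⟨ mat α β γ δ ⟩)
    A≡ : A′ ≡ a
    A≡ = cong Form.a fixes
    B≡ : B′ ≡ b
    B≡ = cong Form.b fixes
    C≡ : C′ ≡ c
    C≡ = cong Form.c fixes
    half : ∀ x y → + 2 * x ≡ + 2 * y → x ≡ y
    half x y = ℤ.*-cancelˡ-≡ (+ 2) x y
    times-det : ∀ x → (α * δ - β * γ) * x ≡ x
    times-det x = trans (cong (_* x) det≡1) (ℤ.*-identityˡ x)

  -- The next two relations are entries of G M = M⁻ᵀ G, where G is the Gram matrix of the form.
  fixes-a[α-δ] : a * (α - δ) ≡ - (b * γ)
  fixes-a[α-δ] = half (a * (α - δ)) (- (b * γ)) (begin
    + 2 * (a * (α - δ))                                              ≡⟨ e₁ a b α γ δ ⟩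
    + 2 * a * α + b * γ - (+ 2 * a * δ + b * γ)                      ≡⟨ cong (_- (+ 2 * a * δ + b * γ)) (times-det (+ 2 * a * α + b * γ)) ⟨
    (α * δ - β * γ) * (+ 2 * a * α + b * γ) - (+ 2 * a * δ + b * γ)  ≡⟨ cong (_- (+ 2 * a * δ + b * γ)) (e₂ a b c α β γ δ) ⟩
    + 2 * δ * A′ - γ * B′ - (+ 2 * a * δ + b * γ)                    ≡⟨ cong₂ (λ s t → + 2 * δ * s - γ * t - (+ 2 * a * δ + b * γ)) A≡ B≡ ⟩
    + 2 * δ * a - γ * b - (+ 2 * a * δ + b * γ)                      ≡⟨ e₃ a b γ δ ⟩
    + 2 * - (b * γ)                                                  ∎)
    where
    e₁ : ∀ a b α γ δ → + 2 * (a * (α - δ)) ≡ + 2 * a * α + b * γ - (+ 2 * a * δ + b * γ)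
    e₁ = solve-∀
    e₂ : ∀ a b c α β γ δ → (α * δ - β * γ) * (+ 2 * a * α + b * γ)
      ≡ + 2 * δ * (a * α * α + b * α * γ + c * γ * γ)
        - γ * (+ 2 * a * α * β + b * (α * δ + β * γ) + + 2 * c * γ * δ)
    e₂ = solve-∀
    e₃ : ∀ a b γ δ → + 2 * δ * a - γ * b - (+ 2 * a * δ + b * γ) ≡ + 2 * - (b * γ)
    e₃ = solve-∀

  fixes-aβ : a * β ≡ - (c * γ)
  fixes-aβ = half (a * β) (- (c * γ)) (begin
    + 2 * (a * β)                                                    ≡⟨ e₁ a b β δ ⟩
    + 2 * a * β + b * δ - b * δ                                      ≡⟨ cong (_- b * δ) (times-det (+ 2 * a * β + b * δ)) ⟨
    (α * δ - β * γ) * (+ 2 * a * β + b * δ) - b * δ                  ≡⟨ cong (_- b * δ) (e₂ a b c α β γ δ) ⟩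
    δ * B′ - + 2 * γ * C′ - b * δ                                    ≡⟨ cong₂ (λ s t → δ * s - + 2 * γ * t - b * δ) B≡ C≡ ⟩
    δ * b - + 2 * γ * c - b * δ                                      ≡⟨ e₃ b c γ δ ⟩
    + 2 * - (c * γ)                                                  ∎)
    where
    e₁ : ∀ a b β δ → + 2 * (a * β) ≡ + 2 * a * β + b * δ - b * δ
    e₁ = solve-∀
    e₂ : ∀ a b c α β γ δ → (α * δ - β * γ) * (+ 2 * a * β + b * δ)
      ≡ δ * (+ 2 * a * α * β + b * (α * δ + β * γ) + + 2 * c * γ * δ)
        - + 2 * γ * (a * β * β + b * β * δ + c * δ * δ)
    e₂ = solve-∀
    e₃ : ∀ b c γ δ → δ * b - + 2 * γ * c - b * δ ≡ + 2 * - (c * γ)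
    e₃ = solve-∀

-- By the two relations above, bγ and cγ are multiples of a, as aγ is. Primitivity then gives a ∣ γ,
-- and u is the quotient; the same relations, divided by a, determine β and δ.
automorph⇒unit : ∀ F M .{{_ : NonZero (Form.a F)}} → Primitive F → Automorph F M → ∃ λ e → norm F e ≡ + 1 × M ≡ unit F e
automorph⇒unit F@(form a b c) M@(mat α β γ δ) prim auto@(det≡1 , fixes) = shape (primitive-cancel a b c prim γ
    (∣m⇒∣m*n γ ∣.∣-refl)
    (divides (- (α - δ)) (trans (neg-eq (fixes-a[α-δ] {a} {b} {c} {α} {β} {γ} {δ} det≡1 fixes)) (e₁ a (α - δ))))
    (divides (- β) (trans (neg-eq (fixes-aβ {a} {b} {c} {α} {β} {γ} {δ} det≡1 fixes)) (e₁ a β))))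
  where
  neg-eq : ∀ {x y} → x ≡ - y → y ≡ - x
  neg-eq {x} {y} refl = sym (ℤ.neg-involutive y)
  e₁ : ∀ a x → - (a * x) ≡ - x * a
  e₁ = solve-∀
  shape : a ∣ γ → ∃ λ e → norm F e ≡ + 1 × M ≡ unit F e
  shape (divides u γ≡) = (α , u) , trans (sym (det≡ a b c α u)) (trans (cong det (sym M≡)) det≡1) , M≡
    where
    open ≡-Reasoning
    e₂ : ∀ a c u → - (c * (u * a)) ≡ a * - (c * u)
    e₂ = solve-∀
    e₃ : ∀ α δ → δ ≡ α - (α - δ)
    e₃ = solve-∀
    e₄ : ∀ α b u → α - - (b * u) ≡ α + b * u
    e₄ = solve-∀
    det≡ : ∀ a b c α u → α * (α + b * u) - - (c * u) * (a * u) ≡ α * α + b * α * u + a * c * (u * u)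
    det≡ = solve-∀
    β≡ : β ≡ - (c * u)
    β≡ = ℤ.*-cancelˡ-≡ a β (- (c * u)) (begin
      a * β            ≡⟨ fixes-aβ {a} {b} {c} {α} {β} {γ} {δ} det≡1 fixes ⟩
      - (c * γ)        ≡⟨ cong (λ z → - (c * z)) γ≡ ⟩
      - (c * (u * a))  ≡⟨ e₂ a c u ⟩
      a * - (c * u)    ∎)
    α-δ≡ : α - δ ≡ - (b * u)
    α-δ≡ = ℤ.*-cancelˡ-≡ a (α - δ) (- (b * u)) (begin
      a * (α - δ)      ≡⟨ fixes-a[α-δ] {a} {b} {c} {α} {β} {γ} {δ} det≡1 fixes ⟩
      - (b * γ)        ≡⟨ cong (λ z → - (b * z)) γ≡ ⟩
      - (b * (u * a))  ≡⟨ e₂ a b u ⟩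
      a * - (b * u)    ∎)
    M≡ : M ≡ unit F (α , u)
    M≡ = mat-≡ refl β≡ (trans γ≡ (ℤ.*-comm u a)) (trans (e₃ α δ) (trans (cong (λ z → α - z) α-δ≡) (e₄ α b u)))

-- Solutions of the norm equation

parity : ∀ b → ∃ λ k → (b ≡ + 2 * k) ⊎ (b ≡ + 2 * k + + 1)
parity b = b /ℕ 2 , cases (b %ℕ 2) (n%ℕd<d b 2) (a≡a%ℕn+[a/ℕn]*n b 2)
  where
  even : ∀ q → + 0 + q * + 2 ≡ + 2 * q
  even = solve-∀
  odd : ∀ q → + 1 + q * + 2 ≡ + 2 * q + + 1
  odd = solve-∀
  cases : ∀ r → r ℕ.< 2 → b ≡ + r + (b /ℕ 2) * + 2 → (b ≡ + 2 * (b /ℕ 2)) ⊎ (b ≡ + 2 * (b /ℕ 2) + + 1)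
  cases 0 _ eq = inj₁ (trans eq (even (b /ℕ 2)))
  cases 1 _ eq = inj₂ (trans eq (odd (b /ℕ 2)))
  cases (suc (suc r)) (ℕ.s≤s (ℕ.s≤s ())) eq

-- The solutions of x² + dv² = 4 for d = |Δ|, where x is the absolute value of the trace 2α + bu and
-- v that of u.
data SmallSolution (d x v : ℕ) : Set where
  trivial  : v ≡ 0 → x ≡ 2 → SmallSolution d x v
  d≡3 : d ≡ 3 → v ≡ 1 → x ≡ 1 → SmallSolution d x v
  d≡4 : d ≡ 4 → v ≡ 1 → x ≡ 0 → SmallSolution d x v

-- With d at least 3, v ≥ 2 would give at least 3·2² > 4 and x ≥ 3 at least 3² > 4, which leaves
-- finitely many pairs.
small-solution : ∀ d x v → 3 ℕ.≤ d → x ℕ.* x ℕ.+ d ℕ.* (v ℕ.* v) ≡ 4 → SmallSolution d x v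
small-solution d x v 3≤d eq = go d x v 3≤d v<2 x<3 eq
  where
  open ℕ.≤-Reasoning
  v<2 : v ℕ.< 2
  v<2 = ℕ.≰⇒> λ 2≤v → ℕ.<⇒≱ {4} {12} (ℕ.m≤m+n 5 7) (begin
    3 ℕ.* (2 ℕ.* 2)                      ≤⟨ ℕ.*-mono-≤ 3≤d (ℕ.*-mono-≤ 2≤v 2≤v) ⟩
    d ℕ.* (v ℕ.* v)                      ≤⟨ ℕ.m≤n+m _ (x ℕ.* x) ⟩
    x ℕ.* x ℕ.+ d ℕ.* (v ℕ.* v)          ≡⟨ eq ⟩
    4                                    ∎)
  x<3 : x ℕ.< 3
  x<3 = ℕ.≰⇒> λ 3≤x → ℕ.<⇒≱ {4} {9} (ℕ.m≤m+n 5 4) (begin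
    3 ℕ.* 3                              ≤⟨ ℕ.*-mono-≤ 3≤x 3≤x ⟩
    x ℕ.* x                              ≤⟨ ℕ.m≤m+n (x ℕ.* x) _ ⟩
    x ℕ.* x ℕ.+ d ℕ.* (v ℕ.* v)          ≡⟨ eq ⟩
    4                                    ∎)
  go : ∀ d x v → 3 ℕ.≤ d → v ℕ.< 2 → x ℕ.< 3 → x ℕ.* x ℕ.+ d ℕ.* (v ℕ.* v) ≡ 4 → SmallSolution d x v
  go d 0 0 _ _ _ eq with () ← trans (sym (ℕ.*-zeroʳ d)) eq
  go d 1 0 _ _ _ eq with () ← trans (cong suc (sym (ℕ.*-zeroʳ d))) eq
  go d 2 0 _ _ _ eq = trivial refl refl
  go d 0 1 _ _ _ eq = d≡4 (trans (sym (ℕ.*-identityʳ d)) eq) refl refl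
  go d 1 1 _ _ _ eq = d≡3 (trans (sym (ℕ.*-identityʳ d)) (ℕ.suc-injective eq)) refl refl
  go (suc d) 2 1 _ _ _ ()
  go d (suc (suc (suc x))) v _ _ (ℕ.s≤s (ℕ.s≤s (ℕ.s≤s ()))) _
  go d x (suc (suc v)) _ (ℕ.s≤s (ℕ.s≤s ())) _ _

abs-cases : ∀ {x n} → ∣ x ∣ ≡ n → (x ≡ + n) ⊎ (x ≡ - + n)
abs-cases {+ n}      refl = inj₁ refl
abs-cases { -[1+ n ]} refl = inj₂ refl

-- Completing the square: four times the norm is (2α + bu)² - Δu².
norm-solution : ∀ F α u → norm F (α , u) ≡ + 1 → disc F ℤ.< + 0 → + 3 ℤ.≤ - disc F →
  SmallSolution (∣ disc F ∣) (∣ + 2 * α + Form.b F * u ∣) (∣ u ∣)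
norm-solution F@(form a b c) α u n≡1 Δ<0 3≤d = small-solution (∣ disc F ∣) X V (bound (disc F) Δ<0 3≤d)
    (ℤ.+-injective (begin
      + (X ℕ.* X ℕ.+ ∣ disc F ∣ ℕ.* (V ℕ.* V))          ≡⟨ cong (λ t → + (X ℕ.* X) + t) (ℤ.pos-* (∣ disc F ∣) (V ℕ.* V)) ⟩
      + (X ℕ.* X) + + ∣ disc F ∣ * + (V ℕ.* V)          ≡⟨ cong₂ (λ s t → s + + ∣ disc F ∣ * t) (square-pos x) (square-pos u) ⟨
      x * x + + ∣ disc F ∣ * (u * u)                    ≡⟨ cong (λ t → x * x + t * (u * u)) (abs-neg (disc F) Δ<0) ⟩
      x * x + - disc F * (u * u)                        ≡⟨ identity a b c α u ⟩
      + 4 * norm F (α , u)                              ≡⟨ cong (+ 4 *_) n≡1 ⟩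
      + 4                                               ∎))
  where
  open ≡-Reasoning
  x = + 2 * α + b * u
  X = ∣ x ∣
  V = ∣ u ∣
  identity : ∀ a b c α u → (+ 2 * α + b * u) * (+ 2 * α + b * u) + - (b * b - + 4 * a * c) * (u * u)
    ≡ + 4 * (α * α + b * α * u + a * c * (u * u))
  identity = solve-∀
  abs-neg : ∀ Δ → Δ ℤ.< + 0 → + ∣ Δ ∣ ≡ - Δ
  abs-neg -[1+ d ] _ = refl
  abs-neg (+ d) (ℤ.+<+ ())
  bound : ∀ Δ → Δ ℤ.< + 0 → + 3 ℤ.≤ - Δ → 3 ℕ.≤ ∣ Δ ∣
  bound -[1+ d ] _ (ℤ.+≤+ 3≤) = 3≤
  bound (+ d) (ℤ.+<+ ()) _

-- Representatives modulo ±1 of the solutions of norm = 1.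
record Units (F : Form) : Set where
  field
    units    : List (ℤ × ℤ)
    norm≡1   : ∀ {e} → e ∈ units → norm F e ≡ + 1
    distinct : AllPairs (λ e e′ → ∣ cross e e′ ∣ ≡ 1) units
    complete : ∀ α u → norm F (α , u) ≡ + 1 → ∃ λ e → e ∈ units × ((α , u) ≡ e ⊎ (α , u) ≡ (- proj₁ e , - proj₂ e))
    count    : length units ≡ wOf (disc F)

wOf-other : ∀ Δ → Δ ≢ - + 3 → Δ ≢ - + 4 → wOf Δ ≡ 1
wOf-other Δ ≢3 ≢4 =
  trans (cong (λ t → if t then 3 else (if does (Δ ℤ.≟ - + 4) then 2 else 1)) (dec-false (Δ ℤ.≟ - + 3) ≢3))
        (cong (λ t → if t then 2 else 1) (dec-false (Δ ℤ.≟ - + 4) ≢4))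

norm[1,0] : ∀ F → norm F (+ 1 , + 0) ≡ + 1
norm[1,0] (form a b c) = identity a b c
  where
  identity : ∀ a b c → + 1 * + 1 + b * + 1 * + 0 + a * c * (+ 0 * + 0) ≡ + 1
  identity = solve-∀

trivial-unit : ∀ b α u → ∣ u ∣ ≡ 0 → ∣ + 2 * α + b * u ∣ ≡ 2 → ((α , u) ≡ (+ 1 , + 0)) ⊎ ((α , u) ≡ (- + 1 , - + 0))
trivial-unit b α u u≡0 x≡2 rewrite ℤ.∣i∣≡0⇒i≡0 {u} u≡0 = signs (abs-cases {+ 2 * α + b * + 0} x≡2)
  where
  identity : ∀ b α → + 2 * α + b * + 0 ≡ + 2 * α
  identity = solve-∀
  signs : (+ 2 * α + b * + 0 ≡ + 2) ⊎ (+ 2 * α + b * + 0 ≡ - + 2) → ((α , + 0) ≡ (+ 1 , + 0)) ⊎ ((α , + 0) ≡ (- + 1 , - + 0))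
  signs (inj₁ eq) = inj₁ (cong (_, + 0) (ℤ.*-cancelˡ-≡ (+ 2) α (+ 1) (trans (sym (identity b α)) eq)))
  signs (inj₂ eq) = inj₂ (cong (_, + 0) (ℤ.*-cancelˡ-≡ (+ 2) α (- + 1) (trans (sym (identity b α)) eq)))

disc-even : ∀ a k c → + 2 * k * (+ 2 * k) - + 4 * a * c ≡ (k * k - a * c) * + 4
disc-even = solve-∀

disc-odd : ∀ a k c → (+ 2 * k + + 1) * (+ 2 * k + + 1) - + 4 * a * c - + 1 ≡ (k * k + k - a * c) * + 4
disc-odd = solve-∀

disc-mod-4 : ∀ F → (+ 4 ∣ disc F) ⊎ (+ 4 ∣ disc F - + 1)
disc-mod-4 (form a b c) = cases (parity b)
  where
  cases : (∃ λ k → (b ≡ + 2 * k) ⊎ (b ≡ + 2 * k + + 1)) → (+ 4 ∣ disc (form a b c)) ⊎ (+ 4 ∣ disc (form a b c) - + 1)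
  cases (k , inj₁ refl) = inj₁ (divides (k * k - a * c) (disc-even a k c))
  cases (k , inj₂ refl) = inj₂ (divides (k * k + k - a * c) (disc-odd a k c))

-- Discriminants are 0 or 1 modulo 4, which rules out -1 and -2.
disc<-2 : ∀ F → disc F ℤ.< + 0 → + 3 ℤ.≤ - disc F
disc<-2 F Δ<0 = go (disc F) Δ<0 (disc-mod-4 F)
  where
  go : ∀ Δ → Δ ℤ.< + 0 → (+ 4 ∣ Δ) ⊎ (+ 4 ∣ Δ - + 1) → + 3 ℤ.≤ - Δ
  go (+ d) (ℤ.+<+ ()) _
  go -[1+ 0 ] _ (inj₁ 4∣) = contradiction 4∣ (from-no (+ 4 ∣? - + 1))
  go -[1+ 0 ] _ (inj₂ 4∣) = contradiction 4∣ (from-no (+ 4 ∣? - + 2))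
  go -[1+ 1 ] _ (inj₁ 4∣) = contradiction 4∣ (from-no (+ 4 ∣? - + 2))
  go -[1+ 1 ] _ (inj₂ 4∣) = contradiction 4∣ (from-no (+ 4 ∣? - + 3))
  go -[1+ suc (suc d) ] _ _ = ℤ.+≤+ (ℕ.s≤s (ℕ.s≤s (ℕ.s≤s ℕ.z≤n)))

units-other : ∀ F → disc F ℤ.< + 0 → disc F ≢ - + 3 → disc F ≢ - + 4 → Units F
units-other F Δ<0 ≢3 ≢4 = record
  { units    = (+ 1 , + 0) ∷ []
  ; norm≡1   = λ { (here refl) → norm[1,0] F }
  ; distinct = [] ∷ []
  ; complete = λ α u n≡1 → (+ 1 , + 0) , here refl , only α u (norm-solution F α u n≡1 Δ<0 (disc<-2 F Δ<0))
  ; count    = sym (wOf-other (disc F) ≢3 ≢4)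
  }
  where
  negative : ∀ Δ n → Δ ℤ.< + 0 → ∣ Δ ∣ ≡ n → Δ ≡ - + n
  negative -[1+ d ] _ _ refl = refl
  negative (+ d) _ (ℤ.+<+ ()) _
  only : ∀ α u → SmallSolution (∣ disc F ∣) (∣ + 2 * α + Form.b F * u ∣) (∣ u ∣) →
         ((α , u) ≡ (+ 1 , + 0)) ⊎ ((α , u) ≡ (- + 1 , - + 0))
  only α u (trivial u≡0 x≡2) = trivial-unit (Form.b F) α u u≡0 x≡2
  only α u (d≡3 eq _ _) = contradiction (negative (disc F) 3 Δ<0 eq) ≢3
  only α u (d≡4 eq _ _) = contradiction (negative (disc F) 4 Δ<0 eq) ≢4

-- Here k² - ac = -1, so T - k squares to -1: the units modulo ±1 are 1 and this fourth root of
-- unity.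
units-4 : ∀ a k c → disc (form a (+ 2 * k) c) ≡ - + 4 → Units (form a (+ 2 * k) c)
units-4 a k c Δ≡ = record
  { units    = (+ 1 , + 0) ∷ (- k , + 1) ∷ []
  ; norm≡1   = λ { (here refl) → norm[1,0] F ; (there (here refl)) → norm≡ }
  ; distinct = (cong ∣_∣ (cross≡ k) ∷ []) ∷ [] ∷ []
  ; complete = λ α u n≡1 → only α u (norm-solution F α u n≡1 Δ<0 (disc<-2 F Δ<0))
  ; count    = cong wOf (sym Δ≡)
  }
  where
  F = form a (+ 2 * k) c
  Δ<0 : disc F ℤ.< + 0
  Δ<0 = subst (ℤ._< + 0) (sym Δ≡) ℤ.-<+
  cross≡ : ∀ k → + 1 * + 1 - + 0 * - k ≡ + 1
  cross≡ = solve-∀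
  e₁ : ∀ a k c → - k * - k + + 2 * k * - k * + 1 + a * c * (+ 1 * + 1) ≡ - (k * k - a * c)
  e₁ = solve-∀
  norm≡ : norm F (- k , + 1) ≡ + 1
  norm≡ = trans (e₁ a k c) (cong -_ (ℤ.*-cancelʳ-≡ (k * k - a * c) (- + 1) (+ 4) (trans (sym (disc-even a k c)) Δ≡)))
  e₂ : ∀ k α → α ≡ - k + (α + k)
  e₂ = solve-∀
  e₃ : ∀ k α → + 2 * α + + 2 * k * + 1 ≡ + 2 * (α + k)
  e₃ = solve-∀
  e₄ : ∀ k α → + 2 * α + + 2 * k * - + 1 ≡ + 2 * (α - k)
  e₄ = solve-∀
  e₅ : ∀ k α → α ≡ - - k + (α - k)
  e₅ = solve-∀
  halves : ∀ x → ∣ + 2 * x ∣ ≡ 0 → x ≡ + 0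
  halves x eq = ℤ.*-cancelˡ-≡ (+ 2) x (+ 0) (ℤ.∣i∣≡0⇒i≡0 eq)
  only : ∀ α u → SmallSolution (∣ disc F ∣) (∣ + 2 * α + + 2 * k * u ∣) (∣ u ∣) →
         ∃ λ e → e ∈ ((+ 1 , + 0) ∷ (- k , + 1) ∷ []) × ((α , u) ≡ e ⊎ (α , u) ≡ (- proj₁ e , - proj₂ e))
  only α u (trivial u≡0 x≡2) = (+ 1 , + 0) , here refl , trivial-unit (+ 2 * k) α u u≡0 x≡2
  only α u (d≡3 eq _ _) with () ← trans (sym (cong ∣_∣ Δ≡)) eq
  only α u (d≡4 _ u≡1 x≡0) = (- k , + 1) , there (here refl) , signs (abs-cases u≡1)
    where
    signs : (u ≡ + 1) ⊎ (u ≡ - + 1) → ((α , u) ≡ (- k , + 1)) ⊎ ((α , u) ≡ (- - k , - + 1))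
    signs (inj₁ refl) = inj₁ (cong (_, + 1) (trans (e₂ k α)
      (trans (cong (λ z → - k + z) (halves (α + k) (trans (cong ∣_∣ (sym (e₃ k α))) x≡0))) (ℤ.+-identityʳ (- k)))))
    signs (inj₂ refl) = inj₂ (cong (_, - + 1) (trans (e₅ k α)
      (trans (cong (λ z → - - k + z) (halves (α - k) (trans (cong ∣_∣ (sym (e₄ k α))) x≡0))) (ℤ.+-identityʳ (- - k)))))

-- Here ζ = T - k has trace and determinant 1, so it is a primitive sixth root of unity. The units
-- modulo ±1 are 1, ζ and its conjugate 1 - ζ, which is (k + 1) - T.
units-3 : ∀ a k c → disc (form a (+ 2 * k + + 1) c) ≡ - + 3 → Units (form a (+ 2 * k + + 1) c)
units-3 a k c Δ≡ = record
  { units    = (+ 1 , + 0) ∷ (- k , + 1) ∷ (k + + 1 , - + 1) ∷ []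
  ; norm≡1   = λ { (here refl) → norm[1,0] F ; (there (here refl)) → norm₁ ; (there (there (here refl))) → norm₂ }
  ; distinct = (cong ∣_∣ (cross₁ k) ∷ cong ∣_∣ (cross₂ k) ∷ []) ∷ (cong ∣_∣ (cross₃ k) ∷ []) ∷ [] ∷ []
  ; complete = λ α u n≡1 → only α u (norm-solution F α u n≡1 Δ<0 (disc<-2 F Δ<0))
  ; count    = cong wOf (sym Δ≡)
  }
  where
  F = form a (+ 2 * k + + 1) c
  Δ<0 : disc F ℤ.< + 0
  Δ<0 = subst (ℤ._< + 0) (sym Δ≡) ℤ.-<+
  cross₁ : ∀ k → + 1 * + 1 - + 0 * - k ≡ + 1
  cross₁ = solve-∀
  cross₂ : ∀ k → + 1 * - + 1 - + 0 * (k + + 1) ≡ - + 1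
  cross₂ = solve-∀
  cross₃ : ∀ k → - k * - + 1 - + 1 * (k + + 1) ≡ - + 1
  cross₃ = solve-∀
  e₁ : ∀ a k c → - k * - k + (+ 2 * k + + 1) * - k * + 1 + a * c * (+ 1 * + 1) ≡ - (k * k + k - a * c)
  e₁ = solve-∀
  e₂ : ∀ a k c → (k + + 1) * (k + + 1) + (+ 2 * k + + 1) * (k + + 1) * - + 1 + a * c * (- + 1 * - + 1) ≡ - (k * k + k - a * c)
  e₂ = solve-∀
  ac≡ : - (k * k + k - a * c) ≡ + 1
  ac≡ = cong -_ (ℤ.*-cancelʳ-≡ (k * k + k - a * c) (- + 1) (+ 4) (trans (sym (disc-odd a k c)) (cong (_- + 1) Δ≡)))
  norm₁ : norm F (- k , + 1) ≡ + 1
  norm₁ = trans (e₁ a k c) ac≡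
  norm₂ : norm F (k + + 1 , - + 1) ≡ + 1
  norm₂ = trans (e₂ a k c) ac≡
  cancel : ∀ x s → x ≡ x + s - s
  cancel = solve-∀
  shift : ∀ α s t → + 2 * α + s ≡ + 2 * t + s → α ≡ t
  shift α s t eq = ℤ.*-cancelˡ-≡ (+ 2) α t (trans (cancel (+ 2 * α) s) (trans (cong (_- s) eq) (sym (cancel (+ 2 * t) s))))
  f₁ : ∀ k → + 1 ≡ + 2 * - k + (+ 2 * k + + 1) * + 1
  f₁ = solve-∀
  f₂ : ∀ k → - + 1 ≡ + 2 * - (k + + 1) + (+ 2 * k + + 1) * + 1
  f₂ = solve-∀
  f₃ : ∀ k → + 1 ≡ + 2 * (k + + 1) + (+ 2 * k + + 1) * - + 1
  f₃ = solve-∀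
  f₄ : ∀ k → - + 1 ≡ + 2 * - - k + (+ 2 * k + + 1) * - + 1
  f₄ = solve-∀
  us = (+ 1 , + 0) ∷ (- k , + 1) ∷ (k + + 1 , - + 1) ∷ []
  only : ∀ α u → SmallSolution (∣ disc F ∣) (∣ + 2 * α + (+ 2 * k + + 1) * u ∣) (∣ u ∣) →
         ∃ λ e → e ∈ us × ((α , u) ≡ e ⊎ (α , u) ≡ (- proj₁ e , - proj₂ e))
  only α u (trivial u≡0 x≡2) = (+ 1 , + 0) , here refl , trivial-unit (+ 2 * k + + 1) α u u≡0 x≡2
  only α u (d≡4 eq _ _) with () ← trans (sym (cong ∣_∣ Δ≡)) eq
  only α u (d≡3 _ u≡1 x≡1) = signs (abs-cases u≡1) (abs-cases x≡1)
    where
    -- The signs of u and of the trace select one of ±ζ and ±(1 - ζ).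
    signs : (u ≡ + 1) ⊎ (u ≡ - + 1) →
            (+ 2 * α + (+ 2 * k + + 1) * u ≡ + 1) ⊎ (+ 2 * α + (+ 2 * k + + 1) * u ≡ - + 1) →
            ∃ λ e → e ∈ us × ((α , u) ≡ e ⊎ (α , u) ≡ (- proj₁ e , - proj₂ e))
    signs (inj₁ refl) (inj₁ x≡) = (- k , + 1) , there (here refl) ,
      inj₁ (cong (_, + 1) (shift α ((+ 2 * k + + 1) * + 1) (- k) (trans x≡ (f₁ k))))
    signs (inj₁ refl) (inj₂ x≡) = (k + + 1 , - + 1) , there (there (here refl)) ,
      inj₂ (cong (_, + 1) (shift α ((+ 2 * k + + 1) * + 1) (- (k + + 1)) (trans x≡ (f₂ k))))
    signs (inj₂ refl) (inj₁ x≡) = (k + + 1 , - + 1) , there (there (here refl)) ,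
      inj₁ (cong (_, - + 1) (shift α ((+ 2 * k + + 1) * - + 1) (k + + 1) (trans x≡ (f₃ k))))
    signs (inj₂ refl) (inj₂ x≡) = (- k , + 1) , there (here refl) ,
      inj₂ (cong (_, - + 1) (shift α ((+ 2 * k + + 1) * - + 1) (- - k) (trans x≡ (f₄ k))))

-- Since Δ ≡ b² modulo 4, the values -3 and -4 force b to be odd and even respectively.
units-of : ∀ F → disc F ℤ.< + 0 → Units F
units-of F@(form a b c) Δ<0 = by-disc (disc F ℤ.≟ - + 3) (disc F ℤ.≟ - + 4)
  where
  three : disc F ≡ - + 3 → (∃ λ k → (b ≡ + 2 * k) ⊎ (b ≡ + 2 * k + + 1)) → Units F
  three Δ≡ (k , inj₂ refl) = units-3 a k c Δ≡
  three Δ≡ (k , inj₁ refl) = contradiction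
    (divides (k * k - a * c) (trans (sym Δ≡) (disc-even a k c))) (from-no (+ 4 ∣? - + 3))
  four : disc F ≡ - + 4 → (∃ λ k → (b ≡ + 2 * k) ⊎ (b ≡ + 2 * k + + 1)) → Units F
  four Δ≡ (k , inj₁ refl) = units-4 a k c Δ≡
  four Δ≡ (k , inj₂ refl) = contradiction
    (divides (k * k + k - a * c) (trans (sym (cong (_- + 1) Δ≡)) (disc-odd a k c))) (from-no (+ 4 ∣? - + 5))
  by-disc : Dec (disc F ≡ - + 3) → Dec (disc F ≡ - + 4) → Units F
  by-disc (yes Δ≡3) _         = three Δ≡3 (parity b)
  by-disc (no _)    (yes Δ≡4) = four Δ≡4 (parity b)
  by-disc (no Δ≢3)  (no Δ≢4)  = units-other F Δ<0 Δ≢3 Δ≢4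

-- Orbits of lines under automorphs

allPairs-All : {A : Set} {P : A → Set} {R : A → A → Set} {xs : List A} →
               All P xs → AllPairs R xs → AllPairs (λ x y → P x × P y × R x y) xs
allPairs-All []         []         = []
allPairs-All (px ∷ pxs) (rx ∷ rxs) = All.zipWith (λ (py , r) → px , py , r) (pxs , rx) ∷ allPairs-All pxs rxs

module Orbits (p : ℕ) (pp : Prime p) (F : Form) where
  open Modulo p pp
  open Lines p pp

  anisotropic? : ∀ i → Dec (¬ + p ∣ eval F (pt i))
  anisotropic? i = ¬? (+ p ∣? eval F (pt i))

  anisotropic : List (Maybe ℕ)
  anisotropic = filter anisotropic? (lines p)

  multiple⇒∣eval : ∀ v → Multiple v → + p ∣ eval F v
  multiple⇒∣eval v mul = ∣-resp-≡ (trans (sym (eval-scalar F (+ p) u)) (cong (eval F) (proj₂ (multiple⇒scalar v mul)))) (p∣p²x (eval F u))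
    where u = proj₁ (multiple⇒scalar v mul)

  lineOf : ℤ × ℤ → Maybe ℕ
  lineOf v with Multiple? v
  -- A default value: vectors of pℤ² lie on every line, and `lineOf-on` excludes them.
  ... | yes _   = nothing
  ... | no ¬mul = proj₁ (line v ¬mul)

  lineOf-on : ∀ v → ¬ Multiple v → lineOf v ∈ lines p × On (lineOf v) v
  lineOf-on v ¬mul with Multiple? v
  ... | yes mul  = contradiction mul ¬mul
  ... | no ¬mul′ = proj₂ (line v ¬mul′)

  on-on⇒∣cross : ∀ j v w → On j v → On j w → + p ∣ cross v w
  on-on⇒∣cross j v w onv onw = go (on⇒combine j v onv)
    where
    flip : ∀ v w → cross v w ≡ - cross w v
    flip (x , y) (z , t) = identity x y z t
      where
      identity : ∀ x y z t → x * t - y * z ≡ - (z * y - t * x)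
      identity = solve-∀
    go : (∃ λ t → ∃ λ s → v ≡ combine t (pt j) (+ p) s) → + p ∣ cross v w
    go (t , s , v≡) = ∣-resp-≡ (sym (trans (cong (λ v → cross v w) v≡) (cross-combine t (pt j) (+ p) s w)))
      (∣m∣n⇒∣m+n (∣n⇒∣m*n t (∣-resp-≡ (sym (flip (pt j) w)) (∣m⇒∣-m onw))) (∣m⇒∣m*n (cross s w) ∣.∣-refl))

  module _ (prim : Primitive F) .{{_ : NonZero (Form.a F)}} (𝓤 : Units F) where
    open Units 𝓤

    -- The list consists of the lines through the images of `pt i` under the units. Automorphs
    -- preserve values, so none of these images lies in pℤ² and each line is well determined.
    orbit : ∀ i → ¬ + p ∣ eval F (pt i) → Σ (List (Maybe ℕ)) λ ks → Unique ks ×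
      (∀ j → j ∈ ks ⇔ (j ∈ anisotropic × F ⟨ emb p j ⟩ ≋ F ⟨ emb p i ⟩)) × length ks ≡ wOf (disc F)
    orbit i p∤ = map image units , unique , (λ j → mk⇔ (sound j) (hit j)) ,
                 trans (length-map image units) count
      where
      v : ℤ × ℤ → ℤ × ℤ
      v e = unit F e ⊙ pt i
      image : ℤ × ℤ → Maybe ℕ
      image e = lineOf (v e)
      p∤Fv : ∀ e → norm F e ≡ + 1 → ¬ + p ∣ eval F (v e)
      p∤Fv e n≡1 p∣ = p∤ (∣-resp-≡ (eval-automorph {F} {unit F e} (unit-automorph F e n≡1) (pt i)) p∣)
      v-on : ∀ e → norm F e ≡ + 1 → image e ∈ lines p × On (image e) (v e)
      v-on e n≡1 = lineOf-on (v e) (p∤Fv e n≡1 ∘ multiple⇒∣eval (v e))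
      p∤cross : ∀ e e′ → ∣ cross e e′ ∣ ≡ 1 → ¬ + p ∣ cross (v e) (v e′)
      p∤cross (α , u) (α′ , u′) eq p∣ = [ (λ p∣c → p∤1 (∣ᵤ⇒∣ (subst (p ℕ.∣_) eq (∣⇒∣ᵤ p∣c)))) , p∤ ]′
        (euclid (α * u′ - u * α′) (eval F (pt i)) (∣-resp-≡ (unit-cross F α u α′ u′ (pt i)) p∣))
      separate : ∀ e e′ → norm F e ≡ + 1 × norm F e′ ≡ + 1 × ∣ cross e e′ ∣ ≡ 1 → image e ≢ image e′
      separate e e′ (n , n′ , c≡1) eq = p∤cross e e′ c≡1 (on-on⇒∣cross (image e) (v e) (v e′)
        (proj₂ (v-on e n)) (subst (λ j → On j (v e′)) (sym eq) (proj₂ (v-on e′ n′))))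
      unique : Unique (map image units)
      unique = AllPairs.map⁺ (AllPairs.map (λ {e} {e′} → separate e e′) (allPairs-All (All.tabulate norm≡1) distinct))
      sound : ∀ j → j ∈ map image units → j ∈ anisotropic × F ⟨ emb p j ⟩ ≋ F ⟨ emb p i ⟩
      sound j j∈ = go (∈-map⁻ image j∈)
        where
        go : (∃ λ e → e ∈ units × j ≡ image e) → j ∈ anisotropic × F ⟨ emb p j ⟩ ≋ F ⟨ emb p i ⟩
        go (e , e∈ , refl) =
          ∈-filter⁺ anisotropic? (proj₁ on) (λ p∣ → p∤Fv e (norm≡1 e∈) (on-zero F (image e) (v e) (proj₂ on) p∣)) ,
          automorph⇒≋ {F} {unit F e} i (image e) (unit-automorph F e (norm≡1 e∈)) (proj₂ on)
          where on = v-on e (norm≡1 e∈)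
      hit : ∀ j → j ∈ anisotropic × F ⟨ emb p j ⟩ ≋ F ⟨ emb p i ⟩ → j ∈ map image units
      hit j (j∈ , F≋) = go (≋⇒automorph F i j (proj₂ (∈-filter⁻ anisotropic? {xs = lines p} j∈)) F≋)
        where
        place : ∀ e → e ∈ units → On j (v e) → j ∈ map image units
        place e e∈ on = subst (_∈ map image units) (sym j≡) (∈-map⁺ image e∈)
          where
          on′ = v-on e (norm≡1 e∈)
          j≡ : j ≡ image e
          j≡ = line-unique (v e) (proj₁ (∈-filter⁻ anisotropic? {xs = lines p} j∈)) (proj₁ on′)
                 (p∤Fv e (norm≡1 e∈) ∘ multiple⇒∣eval (v e)) on (proj₂ on′)
        signs : ∀ α u → On j (unit F (α , u) ⊙ pt i) →
          (∃ λ e → e ∈ units × ((α , u) ≡ e ⊎ (α , u) ≡ (- proj₁ e , - proj₂ e))) → j ∈ map image units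
        signs α u on (e , e∈ , inj₁ refl) = place e e∈ on
        signs α u on (e , e∈ , inj₂ refl) = place e e∈ (∣-resp-≡
          (trans (cong -_ (unit-neg-cross F (proj₁ e) (proj₂ e) (pt i) (pt j))) (ℤ.neg-involutive (cross (v e) (pt j))))
          (∣m⇒∣-m on))
        unit-case : ∀ M → On j (M ⊙ pt i) → (∃ λ e → norm F e ≡ + 1 × M ≡ unit F e) → j ∈ map image units
        unit-case M on ((α , u) , n≡1 , M≡) = signs α u (subst (λ M → On j (M ⊙ pt i)) M≡ on) (complete α u n≡1)
        go : (∃ λ M → Automorph F M × On j (M ⊙ pt i)) → j ∈ map image units
        go (M , auto , on) = unit-case M on (automorph⇒unit F M prim auto)

-- Isotropic lines and the Kronecker symbol

%ℕ-unique : ∀ n d .{{_ : ℕ.NonZero d}} r q → r ℕ.< d → n ≡ + r + q * + d → n %ℕ d ≡ r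
%ℕ-unique n d r q r<d n≡ = residue-unique (n%ℕd<d n d) r<d (divides (q - n /ℕ d) (begin
  + (n %ℕ d) - + r                                        ≡⟨ e₁ (+ (n %ℕ d)) (+ r) ((n /ℕ d) * + d) ⟩
  + (n %ℕ d) + (n /ℕ d) * + d - + r - (n /ℕ d) * + d      ≡⟨ cong (λ z → z - + r - (n /ℕ d) * + d) (trans (sym (a≡a%ℕn+[a/ℕn]*n n d)) n≡) ⟩
  + r + q * + d - + r - (n /ℕ d) * + d                    ≡⟨ e₂ (+ r) q (n /ℕ d) (+ d) ⟩
  (q - n /ℕ d) * + d                                      ∎))
  where
  open ≡-Reasoning
  e₁ : ∀ m r s → m - r ≡ m + s - r - s
  e₁ = solve-∀
  e₂ : ∀ r q s d → r + q * d - r - s * d ≡ (q - s) * d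
  e₂ = solve-∀

-- Of the residues modulo 8 only 0, 1, 4 and 5 have to be treated, since a discriminant is 0 or 1
-- modulo 4.
symb-2-1 : ∀ Δ → Δ %ℕ 8 ≡ 1 → symb Δ 2 ≡ + 1
symb-2-1 Δ eq with Δ %ℕ 8 | eq
... | .1 | refl = refl

symb-2-5 : ∀ Δ → Δ %ℕ 8 ≡ 5 → symb Δ 2 ≡ - + 1
symb-2-5 Δ eq with Δ %ℕ 8 | eq
... | .5 | refl = refl

symb-2-0 : ∀ Δ → Δ %ℕ 8 ≡ 0 → symb Δ 2 ≡ + 0
symb-2-0 Δ eq with Δ %ℕ 8 | eq
... | .0 | refl = refl

symb-2-4 : ∀ Δ → Δ %ℕ 8 ≡ 4 → symb Δ 2 ≡ + 0
symb-2-4 Δ eq with Δ %ℕ 8 | eq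
... | .4 | refl = refl

symb-2-even : ∀ a k c → symb (disc (form a (+ 2 * k) c)) 2 ≡ + 0
symb-2-even a k c = cases (parity (k * k - a * c))
  where
  Δ = disc (form a (+ 2 * k) c)
  e₁ : ∀ m → + 2 * m * + 4 ≡ + 0 + m * + 8
  e₁ = solve-∀
  e₂ : ∀ m → (+ 2 * m + + 1) * + 4 ≡ + 4 + m * + 8
  e₂ = solve-∀
  cases : (∃ λ m → (k * k - a * c ≡ + 2 * m) ⊎ (k * k - a * c ≡ + 2 * m + + 1)) → symb Δ 2 ≡ + 0
  cases (m , inj₁ eq) = symb-2-0 Δ (%ℕ-unique Δ 8 0 m (ℕ.s≤s ℕ.z≤n)
    (trans (disc-even a k c) (trans (cong (_* + 4) eq) (e₁ m))))
  cases (m , inj₂ eq) = symb-2-4 Δ (%ℕ-unique Δ 8 4 m (ℕ.m≤m+n 5 3)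
    (trans (disc-even a k c) (trans (cong (_* + 4) eq) (e₂ m))))

-- Makes (2k + 1)² = 1 + 4k(k + 1) congruent to 1 modulo 8, so that for odd b the parity of ac
-- decides Δ modulo 8.
k[k+1]-even : ∀ k → ∃ λ t → k * k + k ≡ + 2 * t
k[k+1]-even k = cases (parity k)
  where
  e₁ : ∀ m → + 2 * m * (+ 2 * m) + + 2 * m ≡ + 2 * (+ 2 * m * m + m)
  e₁ = solve-∀
  e₂ : ∀ m → (+ 2 * m + + 1) * (+ 2 * m + + 1) + (+ 2 * m + + 1) ≡ + 2 * (+ 2 * m * m + + 3 * m + + 1)
  e₂ = solve-∀
  cases : (∃ λ m → (k ≡ + 2 * m) ⊎ (k ≡ + 2 * m + + 1)) → ∃ λ t → k * k + k ≡ + 2 * t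
  cases (m , inj₁ refl) = + 2 * m * m + m , e₁ m
  cases (m , inj₂ refl) = + 2 * m * m + + 3 * m + + 1 , e₂ m

disc-odd′ : ∀ a k c → (+ 2 * k + + 1) * (+ 2 * k + + 1) - + 4 * a * c ≡ + 1 + (k * k + k) * + 4 - a * c * + 4
disc-odd′ = solve-∀

symb-2-split : ∀ a k c s → a * c ≡ + 2 * s → symb (disc (form a (+ 2 * k + + 1) c)) 2 ≡ + 1
symb-2-split a k c s eq = symb-2-1 Δ (%ℕ-unique Δ 8 1 (t - s) (ℕ.m≤m+n 2 6)
    (trans (disc-odd′ a k c) (trans (cong₂ (λ x y → + 1 + x * + 4 - y * + 4) (proj₂ (k[k+1]-even k)) eq) (e₁ t s))))
  where
  Δ = disc (form a (+ 2 * k + + 1) c)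
  t = proj₁ (k[k+1]-even k)
  e₁ : ∀ t s → + 1 + + 2 * t * + 4 - + 2 * s * + 4 ≡ + 1 + (t - s) * + 8
  e₁ = solve-∀

symb-2-inert : ∀ a k c s → a * c ≡ + 2 * s + + 1 → symb (disc (form a (+ 2 * k + + 1) c)) 2 ≡ - + 1
symb-2-inert a k c s eq = symb-2-5 Δ (%ℕ-unique Δ 8 5 (t - s - + 1) (ℕ.m≤m+n 6 2)
    (trans (disc-odd′ a k c) (trans (cong₂ (λ x y → + 1 + x * + 4 - y * + 4) (proj₂ (k[k+1]-even k)) eq) (e₁ t s))))
  where
  Δ = disc (form a (+ 2 * k + + 1) c)
  t = proj₁ (k[k+1]-even k)
  e₁ : ∀ t s → + 1 + + 2 * t * + 4 - (+ 2 * s + + 1) * + 4 ≡ + 5 + (t - s - + 1) * + 8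
  e₁ = solve-∀

module _ (n : ℕ) where
  private
    p = 3 ℕ.+ n
    test : ℤ → ℕ → Bool
    test Δ x = does (p ℕ.∣? ∣ + x * + x - Δ ∣)

  symb-ramified : ∀ Δ → + p ∣ Δ → symb Δ p ≡ + 0
  symb-ramified Δ p∣Δ = cong (λ t → if t then + 0 else (if any (test Δ) (upTo p) then + 1 else - + 1))
    (dec-true (p ℕ.∣? ∣ Δ ∣) (∣⇒∣ᵤ p∣Δ))

  private
    symb-unramified : ∀ Δ → ¬ + p ∣ Δ → symb Δ p ≡ (if any (test Δ) (upTo p) then + 1 else - + 1)
    symb-unramified Δ p∤Δ = cong (λ t → if t then + 0 else (if any (test Δ) (upTo p) then + 1 else - + 1))
      (dec-false (p ℕ.∣? ∣ Δ ∣) (p∤Δ ∘ ∣ᵤ⇒∣))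

  symb-residue : ∀ Δ x → ¬ + p ∣ Δ → x ∈ upTo p → + p ∣ + x * + x - Δ → symb Δ p ≡ + 1
  symb-residue Δ x p∤Δ x∈ p∣ = trans (symb-unramified Δ p∤Δ)
    (cong (λ t → if t then + 1 else - + 1) (to T-≡ (any⁺ (test Δ) (lose x∈
      (from T-≡ (dec-true (p ℕ.∣? ∣ + x * + x - Δ ∣) (∣⇒∣ᵤ p∣)))))))

  symb-nonresidue : ∀ Δ → ¬ + p ∣ Δ → (∀ x → x ∈ upTo p → ¬ + p ∣ + x * + x - Δ) → symb Δ p ≡ - + 1
  symb-nonresidue Δ p∤Δ none = trans (symb-unramified Δ p∤Δ)
    (cong (λ t → if t then + 1 else - + 1) (no-witness (any (test Δ) (upTo p)) refl))
    where
    does⇒ : ∀ {A : Set} (A? : Dec A) → T (does A?) → A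
    does⇒ (yes a) _ = a
    no-witness : ∀ t → any (test Δ) (upTo p) ≡ t → any (test Δ) (upTo p) ≡ false
    no-witness false eq = eq
    no-witness true eq with x , x∈ , px ← find (any⁻ (test Δ) (upTo p) (from T-≡ eq)) =
      contradiction (∣ᵤ⇒∣ (does⇒ (p ℕ.∣? ∣ + x * + x - Δ ∣) px)) (none x x∈)

length-filter-¬ : {A : Set} {P : A → Set} (P? : ∀ x → Dec (P x)) (xs : List A) →
  length (filter P? xs) ℕ.+ length (filter (¬? ∘ P?) xs) ≡ length xs
length-filter-¬ P? [] = refl
length-filter-¬ P? (x ∷ xs) with P? x
... | yes _ = cong suc (length-filter-¬ P? xs)
... | no _  = trans (ℕ.+-suc _ _) (cong suc (length-filter-¬ P? xs))

-- The number of isotropic lines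

module Isotropic (p : ℕ) (pp : Prime p) (a b c : ℤ) (prim : Primitive (form a b c)) where
  open Modulo p pp
  open Orbits p pp (form a b c)

  private
    F = form a b c
    Δ = disc F

  isotropic? : ∀ i → Dec (+ p ∣ eval F (pt i))
  isotropic? i = + p ∣? eval F (pt i)

  ZeroSet : List (Maybe ℕ) → Set
  ZeroSet zs = Unique zs × (∀ {i} → i ∈ zs → i ∈ lines p × + p ∣ eval F (pt i)) ×
               (∀ {i} → i ∈ lines p → + p ∣ eval F (pt i) → i ∈ zs)

  zeroSet-length : ∀ {zs} → ZeroSet zs → length (filter isotropic? (lines p)) ≡ length zs
  zeroSet-length {zs} (uzs , sound , full) = unique-⇔⇒length≡ (Unique.filter⁺ isotropic? (lines-unique p)) uzs λ i →
    mk⇔ (λ i∈ → let i∈l , p∣ = ∈-filter⁻ isotropic? {xs = lines p} i∈ in full i∈l p∣)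
        (λ i∈ → let i∈l , p∣ = sound i∈ in ∈-filter⁺ isotropic? i∈l p∣)

  eval-∞ : eval F (pt nothing) ≡ a
  eval-∞ = identity a b c
    where
    identity : ∀ a b c → a * + 1 * + 1 + b * + 1 * + 0 + c * + 0 * + 0 ≡ a
    identity = solve-∀

  eval-just : ∀ h → eval F (pt (just h)) ≡ a * + h * + h + b * + h + c
  eval-just h = identity a b c (+ h)
    where
    identity : ∀ a b c h → a * h * h + b * h * + 1 + c * + 1 * + 1 ≡ a * h * h + b * h + c
    identity = solve-∀

  ∞-zero : + p ∣ a → nothing ∈ lines p × + p ∣ eval F (pt nothing)
  ∞-zero p∣a = here refl , ∣-resp-≡ (sym eval-∞) p∣a

  ∞-nonzero : ¬ + p ∣ a → ¬ + p ∣ eval F (pt nothing)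
  ∞-nonzero p∤a p∣ = p∤a (∣-resp-≡ eval-∞ p∣)

  not-all : + p ∣ a → + p ∣ b → ¬ + p ∣ c
  not-all p∣a p∣b p∣c = p∤1 (subst (λ d → + p ∣ + d) (primitive⇒divisor≡1 F prim (p∣a , p∣b , p∣c)) ∣.∣-refl)

  -- There are p + 1 lines, of which 1 + χ are isotropic; the count is made over ℤ because χ may be
  -- -1.
  anisotropic-count : ∀ {zs χ} → ZeroSet zs → + length zs ≡ + 1 + χ → + length anisotropic ≡ + p - χ
  anisotropic-count {zs} {χ} Z eq = begin
    + length anisotropic                                     ≡⟨ e₁ (+ length anisotropic) (+ length zs) ⟩
    + length zs + + length anisotropic - + length zs         ≡⟨ cong₂ (λ s t → + (s ℕ.+ length anisotropic) - t) (sym (zeroSet-length Z)) eq ⟩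
    + (length (filter isotropic? (lines p)) ℕ.+ length anisotropic) - (+ 1 + χ)
                                                             ≡⟨ cong (λ s → + s - (+ 1 + χ)) (length-filter-¬ isotropic? (lines p)) ⟩
    + length (lines p) - (+ 1 + χ)                           ≡⟨ cong (λ s → + suc s - (+ 1 + χ)) (trans (length-map just (upTo p)) (length-upTo p)) ⟩
    + 1 + + p - (+ 1 + χ)                                    ≡⟨ e₂ (+ p) χ ⟩
    + p - χ                                                  ∎
    where
    open ≡-Reasoning
    e₁ : ∀ x y → x ≡ y + x - y
    e₁ = solve-∀
    e₂ : ∀ p χ → + 1 + p - (+ 1 + χ) ≡ p - χ
    e₂ = solve-∀

  private
    unique₁ : ∀ {i : Maybe ℕ} → Unique (i ∷ [])
    unique₁ = [] ∷ []

    unique₂ : ∀ {i j : Maybe ℕ} → i ≢ j → Unique (i ∷ j ∷ [])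
    unique₂ i≢j = (i≢j ∷ []) ∷ [] ∷ []

  module Odd (p∤2 : ¬ + p ∣ + 2) where

    -- Square roots of Δ modulo p range over ℤ here, so that b and 2ah + b can serve as they stand;
    -- `square-residue` reduces them below p for `symb`.
    ZeroCount : Set
    ZeroCount = ∃ λ zs → ZeroSet zs × ((length zs ≡ 1 × + p ∣ Δ)
      ⊎ (length zs ≡ 2 × ¬ + p ∣ Δ × (∃ λ x → + p ∣ x * x - Δ))
      ⊎ (length zs ≡ 0 × ¬ + p ∣ Δ × (∀ x → ¬ + p ∣ x * x - Δ)))

    -- Modulo p the form is cy², and c is prime to p by primitivity: infinity is the only zero.
    ramified-at-∞ : + p ∣ a → + p ∣ b → ZeroCount
    ramified-at-∞ p∣a p∣b = nothing ∷ [] , (unique₁ , (λ { (here refl) → ∞-zero p∣a }) , full) ,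
        inj₁ (refl , ∣m∣n⇒∣m-n (∣m⇒∣m*n b p∣b) (∣m⇒∣m*n c (∣n⇒∣m*n (+ 4) p∣a)))
      where
      full : ∀ {i} → i ∈ lines p → + p ∣ eval F (pt i) → i ∈ nothing ∷ []
      full {nothing} _ _ = here refl
      full {just h} _ p∣ = contradiction (∣m+n∣m⇒∣n (∣-resp-≡ (eval-just h) p∣)
        (∣m∣n⇒∣m+n (∣m⇒∣m*n (+ h) (∣m⇒∣m*n (+ h) p∣a)) (∣m⇒∣m*n (+ h) p∣b))) (not-all p∣a p∣b)

    -- Modulo p the form is y(bx + cy), with zeros at infinity and at h = -c/b, and Δ is the nonzero
    -- square b².
    split-at-∞ : + p ∣ a → ¬ + p ∣ b → ZeroCount
    split-at-∞ p∣a p∤b = nothing ∷ just h₀ ∷ [] , (unique₂ (λ ()) , sound , full) ,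
        inj₂ (inj₁ (refl , p∤Δ , b , ∣-resp-≡ (e₃ a b c) (∣m⇒∣m*n c (∣n⇒∣m*n (+ 4) p∣a))))
      where
      root = linear-root b (- c) p∤b
      h₀ = proj₁ root
      h₀<p = proj₁ (proj₂ root)
      p∣ah² : ∀ h → + p ∣ a * + h * + h
      p∣ah² h = ∣m⇒∣m*n (+ h) (∣m⇒∣m*n (+ h) p∣a)
      e₁ : ∀ a b c h → a * h * h + (b * h - - c) ≡ a * h * h + b * h + c
      e₁ = solve-∀
      e₃ : ∀ a b c → + 4 * a * c ≡ b * b - (b * b - + 4 * a * c)
      e₃ = solve-∀
      e₄ : ∀ a b c → b * b - + 4 * a * c + + 4 * a * c ≡ b * b
      e₄ = solve-∀
      p∤Δ : ¬ + p ∣ Δ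
      p∤Δ p∣Δ = p∤b (euclid-sq b (∣-resp-≡ (e₄ a b c) (∣m∣n⇒∣m+n p∣Δ (∣m⇒∣m*n c (∣n⇒∣m*n (+ 4) p∣a)))))
      sound : ∀ {i} → i ∈ nothing ∷ just h₀ ∷ [] → i ∈ lines p × + p ∣ eval F (pt i)
      sound (here refl) = ∞-zero p∣a
      sound (there (here refl)) = just∈lines h₀<p , ∣-resp-≡ (trans (e₁ a b c (+ h₀)) (sym (eval-just h₀)))
        (∣m∣n⇒∣m+n (p∣ah² h₀) (proj₂ (proj₂ root)))
      full : ∀ {i} → i ∈ lines p → + p ∣ eval F (pt i) → i ∈ nothing ∷ just h₀ ∷ []
      full {nothing} _ _ = here refl
      full {just h} i∈ p∣ = there (here (cong just (linear-root-unique b (- c) p∤b (just∈lines⁻ i∈) h₀<p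
        (∣m+n∣m⇒∣n (∣-resp-≡ (trans (eval-just h) (sym (e₁ a b c (+ h)))) p∣) (p∣ah² h)) (proj₂ (proj₂ root)))))

    module _ (p∤a : ¬ + p ∣ a) where

      p∤2a : ¬ + p ∣ + 2 * a
      p∤2a p∣ = [ p∤2 , p∤a ]′ (euclid (+ 2) a p∣)

      p∤4a : ¬ + p ∣ + 4 * a
      p∤4a p∣ = p∤2a (euclid-∤ˡ (+ 2) (+ 2 * a) p∤2 (∣-resp-≡ (ℤ.*-assoc (+ 2) (+ 2) a) p∣))

      -- Writing 2ah + b as 2ah - (-b) gives the square root the shape of a linear congruence as
      -- solved by `linear-root`.
      complete-square : ∀ h → + 4 * a * eval F (pt (just h)) ≡ (+ 2 * a * + h - - b) * (+ 2 * a * + h - - b) - Δ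
      complete-square h = identity a b c (+ h)
        where
        identity : ∀ a b c h → + 4 * a * (a * h * h + b * h * + 1 + c * + 1 * + 1)
          ≡ (+ 2 * a * h - - b) * (+ 2 * a * h - - b) - (b * b - + 4 * a * c)
        identity = solve-∀

      zero⇒square : ∀ h → + p ∣ eval F (pt (just h)) → + p ∣ (+ 2 * a * + h - - b) * (+ 2 * a * + h - - b) - Δ
      zero⇒square h p∣ = ∣-resp-≡ (complete-square h) (∣n⇒∣m*n (+ 4 * a) p∣)

      square⇒zero : ∀ h → + p ∣ (+ 2 * a * + h - - b) * (+ 2 * a * + h - - b) - Δ → + p ∣ eval F (pt (just h))
      square⇒zero h p∣ = euclid-∤ˡ (+ 4 * a) (eval F (pt (just h))) p∤4a (∣-resp-≡ (sym (complete-square h)) p∣)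

      ramified : + p ∣ Δ → ZeroCount
      ramified p∣Δ = just h₀ ∷ [] , (unique₁ , sound , full) , inj₁ (refl , p∣Δ)
        where
        root = linear-root (+ 2 * a) (- b) p∤2a
        h₀ = proj₁ root
        h₀<p = proj₁ (proj₂ root)
        sound : ∀ {i} → i ∈ just h₀ ∷ [] → i ∈ lines p × + p ∣ eval F (pt i)
        sound (here refl) = just∈lines h₀<p , square⇒zero h₀
          (∣m∣n⇒∣m-n (∣m⇒∣m*n (+ 2 * a * + h₀ - - b) (proj₂ (proj₂ root))) p∣Δ)
        full : ∀ {i} → i ∈ lines p → + p ∣ eval F (pt i) → i ∈ just h₀ ∷ []
        full {nothing} _ p∣ = contradiction p∣ (∞-nonzero p∤a)
        full {just h} i∈ p∣ = here (cong just (linear-root-unique (+ 2 * a) (- b) p∤2a (just∈lines⁻ i∈) h₀<p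
          (euclid-sq (+ 2 * a * + h - - b) (∣m+n∣n⇒∣m (zero⇒square h p∣) (∣m⇒∣-m p∣Δ))) (proj₂ (proj₂ root))))

      split : ¬ + p ∣ Δ → ∀ x → + p ∣ x * x - Δ → ZeroCount
      split p∤Δ x p∣x = just h₁ ∷ just h₂ ∷ [] , (unique₂ (h₁≢h₂ ∘ just-injective) , sound , full) ,
          inj₂ (inj₁ (refl , p∤Δ , x , p∣x))
        where
        root₁ = linear-root (+ 2 * a) (x - b) p∤2a
        root₂ = linear-root (+ 2 * a) (- x - b) p∤2a
        h₁ = proj₁ root₁
        h₂ = proj₁ root₂
        h₁<p = proj₁ (proj₂ root₁)
        h₂<p = proj₁ (proj₂ root₂)
        y : ℕ → ℤ
        y h = + 2 * a * + h
        e₁ : ∀ y b x Δ → (y - (x - b)) * (y - (- x - b)) + (x * x - Δ) ≡ (y - - b) * (y - - b) - Δ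
        e₁ = solve-∀
        e₂ : ∀ y b x → y - (- x - b) - (y - (x - b)) ≡ + 2 * x
        e₂ = solve-∀
        e₃ : ∀ x Δ → x * x - (x * x - Δ) ≡ Δ
        e₃ = solve-∀
        -- If the two roots agreed, p would divide the difference 2x of their targets x - b and -x -
        -- b, hence x and with it Δ.
        h₁≢h₂ : h₁ ≢ h₂
        h₁≢h₂ eq = p∤Δ (∣-resp-≡ (e₃ x Δ) (∣m∣n⇒∣m-n (∣m⇒∣m*n x p∣x′) p∣x))
          where
          p∣x′ : + p ∣ x
          p∣x′ = euclid-∤ˡ (+ 2) x p∤2 (∣-resp-≡ (e₂ (y h₂) b x) (∣m∣n⇒∣m-n (proj₂ (proj₂ root₂))
            (subst (λ h → + p ∣ y h - (x - b)) eq (proj₂ (proj₂ root₁)))))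
        sound : ∀ {i} → i ∈ just h₁ ∷ just h₂ ∷ [] → i ∈ lines p × + p ∣ eval F (pt i)
        sound (here refl) = just∈lines h₁<p , square⇒zero h₁ (∣-resp-≡ (e₁ (y h₁) b x Δ)
          (∣m∣n⇒∣m+n (∣m⇒∣m*n (y h₁ - (- x - b)) (proj₂ (proj₂ root₁))) p∣x))
        sound (there (here refl)) = just∈lines h₂<p , square⇒zero h₂ (∣-resp-≡ (e₁ (y h₂) b x Δ)
          (∣m∣n⇒∣m+n (∣n⇒∣m*n (y h₂ - (x - b)) (proj₂ (proj₂ root₂))) p∣x))
        full : ∀ {i} → i ∈ lines p → + p ∣ eval F (pt i) → i ∈ just h₁ ∷ just h₂ ∷ []
        full {nothing} _ p∣ = contradiction p∣ (∞-nonzero p∤a)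
        full {just h} i∈ p∣ = cases (euclid (y h - (x - b)) (y h - (- x - b))
            (∣m+n∣n⇒∣m (∣-resp-≡ (sym (e₁ (y h) b x Δ)) (zero⇒square h p∣)) p∣x))
          where
          cases : (+ p ∣ y h - (x - b)) ⊎ (+ p ∣ y h - (- x - b)) → just h ∈ just h₁ ∷ just h₂ ∷ []
          cases (inj₁ p∣₁) = here (cong just
            (linear-root-unique (+ 2 * a) (x - b) p∤2a (just∈lines⁻ i∈) h₁<p p∣₁ (proj₂ (proj₂ root₁))))
          cases (inj₂ p∣₂) = there (here (cong just
            (linear-root-unique (+ 2 * a) (- x - b) p∤2a (just∈lines⁻ i∈) h₂<p p∣₂ (proj₂ (proj₂ root₂)))))

      inert : ¬ + p ∣ Δ → (∀ x → ¬ + p ∣ x * x - Δ) → ZeroCount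
      inert p∤Δ none = [] , ([] , (λ ()) , full) , inj₂ (inj₂ (refl , p∤Δ , none))
        where
        full : ∀ {i} → i ∈ lines p → + p ∣ eval F (pt i) → i ∈ []
        full {nothing} _ p∣ = contradiction p∣ (∞-nonzero p∤a)
        full {just h} _ p∣ = contradiction (zero⇒square h p∣) (none (+ 2 * a * + h - - b))

    square-residue : ∀ x → + p ∣ x * x - Δ → ∃ λ h → h ∈ upTo p × + p ∣ + h * + h - Δ
    square-residue x p∣ = h , ∈-upTo⁺ (proj₁ (proj₂ (residue x))) ,
        ∣-resp-≡ (identity x (+ h) Δ) (∣m∣n⇒∣m+n (∣m⇒∣m*n (+ h + x) (proj₂ (proj₂ (residue x)))) p∣)
      where
      h = proj₁ (residue x)
      identity : ∀ x h Δ → (h - x) * (h + x) + (x * x - Δ) ≡ h * h - Δ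
      identity = solve-∀

    square? : Dec (∃ λ x → + p ∣ x * x - Δ)
    square? with Any.any? (λ h → + p ∣? + h * + h - Δ) (upTo p)
    ... | yes found = yes (let h , _ , p∣ = find found in + h , p∣)
    ... | no  none  = no λ (x , p∣) → let h , h∈ , p∣h = square-residue x p∣ in none (lose h∈ p∣h)

    zeroCount : ZeroCount
    zeroCount = cases (+ p ∣? a) (+ p ∣? b) (+ p ∣? Δ) square?
      where
      cases : Dec (+ p ∣ a) → Dec (+ p ∣ b) → Dec (+ p ∣ Δ) → Dec (∃ λ x → + p ∣ x * x - Δ) → ZeroCount
      cases (yes p∣a) (yes p∣b) _ _ = ramified-at-∞ p∣a p∣b
      cases (yes p∣a) (no p∤b)  _ _ = split-at-∞ p∣a p∤b
      cases (no p∤a)  _ (yes p∣Δ) _ = ramified p∤a p∣Δ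
      cases (no p∤a)  _ (no p∤Δ) (yes (x , p∣x)) = split p∤a p∤Δ x p∣x
      cases (no p∤a)  _ (no p∤Δ) (no none) = inert p∤a p∤Δ (λ x p∣x → none (x , p∣x))

-- The prime 2

indicator : {A : Set} → A ⊎ ¬ A → ℕ
indicator (inj₁ _) = 1
indicator (inj₂ _) = 0

-- The case distinction is an argument, so that lines can be counted from parities supplied by hand
-- instead of from what `P?` computes.
length-filter-∷ : {A : Set} {P : A → Set} (P? : ∀ x → Dec (P x)) {x : A} {xs : List A} (s : P x ⊎ ¬ P x) →
  length (filter P? (x ∷ xs)) ≡ indicator s ℕ.+ length (filter P? xs)
length-filter-∷ P? (inj₁ px) = cong length (filter-accept P? px)
length-filter-∷ P? (inj₂ ¬px) = cong length (filter-reject P? ¬px)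

module Two (pp : Prime 2) (a b c : ℤ) (prim : Primitive (form a b c)) where
  open Modulo 2 pp
  open Orbits 2 pp (form a b c)
  open Isotropic 2 pp a b c prim
  private F = form a b c

  Parity : ℤ → Set
  Parity x = (+ 2 ∣ x) ⊎ ¬ + 2 ∣ x

  even : ∀ {x} k → x ≡ + 2 * k → Parity x
  even k eq = inj₁ (divides k (trans eq (ℤ.*-comm (+ 2) k)))

  odd : ∀ {x} k → x ≡ + 2 * k + + 1 → Parity x
  odd k eq = inj₂ λ 2∣x → p∤1 (∣m+n∣m⇒∣n (∣-resp-≡ eq 2∣x) (divides k (ℤ.*-comm (+ 2) k)))

  transport : ∀ {x y} → x ≡ y → Parity x → Parity y
  transport eq (inj₁ 2∣x) = inj₁ (∣-resp-≡ eq 2∣x)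
  transport eq (inj₂ 2∤x) = inj₂ (2∤x ∘ ∣-resp-≡ (sym eq))

  at-∞ : Parity a → Parity (eval F (pt nothing))
  at-∞ = transport (sym eval-∞)

  at-0 : Parity c → Parity (eval F (pt (just 0)))
  at-0 = transport (trans (identity a b c) (sym (eval-just 0)))
    where
    identity : ∀ a b c → c ≡ a * + 0 * + 0 + b * + 0 + c
    identity = solve-∀

  at-1 : Parity (a + b + c) → Parity (eval F (pt (just 1)))
  at-1 = transport (trans (identity a b c) (sym (eval-just 1)))
    where
    identity : ∀ a b c → a + b + c ≡ a * + 1 * + 1 + b * + 1 + c
    identity = solve-∀

  -- The three lines modulo 2 are those of infinity, 0 and 1, with values a, c and a + b + c.
  count : (s∞ : Parity (eval F (pt nothing))) (s₀ : Parity (eval F (pt (just 0)))) (s₁ : Parity (eval F (pt (just 1)))) →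
    ∀ χ → + (indicator s∞ ℕ.+ (indicator s₀ ℕ.+ (indicator s₁ ℕ.+ 0))) ≡ + 1 + χ → + length anisotropic ≡ + 2 - χ
  count s∞ s₀ s₁ χ eq = anisotropic-count {filter isotropic? (lines 2)} {χ}
    (Unique.filter⁺ isotropic? (lines-unique 2) , ∈-filter⁻ isotropic? {xs = lines 2} , ∈-filter⁺ isotropic?)
    (trans (cong +_ (trans (length-filter-∷ isotropic? s∞) (cong (indicator s∞ ℕ.+_)
      (trans (length-filter-∷ isotropic? s₀) (cong (indicator s₀ ℕ.+_) (length-filter-∷ isotropic? s₁)))))) eq)

-- The square cannot be completed modulo 2, but the parities of a, b and c determine everything: the
-- values on the three lines, and the symbol, which is 0 for even b and otherwise 1 or -1 as ac is
-- even or odd. Three even coefficients contradict primitivity.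
anisotropic-length-2 : ∀ (pp : Prime 2) a b c → Primitive (form a b c) →
  + length (Orbits.anisotropic 2 pp (form a b c)) ≡ + 2 - symb (disc (form a b c)) 2
anisotropic-length-2 pp a b c prim = go a b c prim (parity a) (parity b) (parity c)
  where
  o : ∀ k l m → + 2 * k + + 2 * m + (+ 2 * l + + 1) ≡ + 2 * (k + m + l) + + 1
  o = solve-∀
  o′ : ∀ k l m → + 2 * k + + 1 + + 2 * m + + 2 * l ≡ + 2 * (k + m + l) + + 1
  o′ = solve-∀
  oo : ∀ k l m → + 2 * k + + 1 + + 2 * m + (+ 2 * l + + 1) ≡ + 2 * (k + m + l + + 1)
  oo = solve-∀
  m₁ : ∀ k l m → + 2 * k + (+ 2 * m + + 1) + + 2 * l ≡ + 2 * (k + m + l) + + 1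
  m₁ = solve-∀
  m₂ : ∀ k l m → + 2 * k + (+ 2 * m + + 1) + (+ 2 * l + + 1) ≡ + 2 * (k + m + l + + 1)
  m₂ = solve-∀
  m₃ : ∀ k l m → + 2 * k + + 1 + (+ 2 * m + + 1) + + 2 * l ≡ + 2 * (k + m + l + + 1)
  m₃ = solve-∀
  m₄ : ∀ k l m → + 2 * k + + 1 + (+ 2 * m + + 1) + (+ 2 * l + + 1) ≡ + 2 * (k + m + l + + 1) + + 1
  m₄ = solve-∀
  ac₁ : ∀ k c → + 2 * k * c ≡ + 2 * (k * c)
  ac₁ = solve-∀
  ac₂ : ∀ a l → a * (+ 2 * l) ≡ + 2 * (a * l)
  ac₂ = solve-∀
  ac₃ : ∀ k l → (+ 2 * k + + 1) * (+ 2 * l + + 1) ≡ + 2 * (+ 2 * k * l + k + l) + + 1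
  ac₃ = solve-∀
  Par : ℤ → Set
  Par x = ∃ λ k → (x ≡ + 2 * k) ⊎ (x ≡ + 2 * k + + 1)
  go : ∀ a b c (prim : Primitive (form a b c)) → Par a → Par b → Par c →
    + length (Orbits.anisotropic 2 pp (form a b c)) ≡ + 2 - symb (disc (form a b c)) 2
  go a b c prim (k , inj₁ refl) (m , inj₁ refl) (l , inj₁ refl) =
    contradiction (twice l) (Isotropic.not-all 2 pp a b c prim (twice k) (twice m))
    where
    twice : ∀ x → + 2 ∣ + 2 * x
    twice x = divides x (ℤ.*-comm (+ 2) x)
  go a b c prim (k , inj₁ refl) (m , inj₁ refl) (l , inj₂ refl) =
    count (at-∞ (even k refl)) (at-0 (odd l refl)) (at-1 (odd (k + m + l) (o k l m)))
      (symb (disc (form a b c)) 2) (cong (λ χ → + 1 + χ) (sym (symb-2-even a m c)))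
    where open Two pp a b c prim
  go a b c prim (k , inj₂ refl) (m , inj₁ refl) (l , inj₁ refl) =
    count (at-∞ (odd k refl)) (at-0 (even l refl)) (at-1 (odd (k + m + l) (o′ k l m)))
      (symb (disc (form a b c)) 2) (cong (λ χ → + 1 + χ) (sym (symb-2-even a m c)))
    where open Two pp a b c prim
  go a b c prim (k , inj₂ refl) (m , inj₁ refl) (l , inj₂ refl) =
    count (at-∞ (odd k refl)) (at-0 (odd l refl)) (at-1 (even (k + m + l + + 1) (oo k l m)))
      (symb (disc (form a b c)) 2) (cong (λ χ → + 1 + χ) (sym (symb-2-even a m c)))
    where open Two pp a b c prim
  go a b c prim (k , inj₁ refl) (m , inj₂ refl) (l , inj₁ refl) =
    count (at-∞ (even k refl)) (at-0 (even l refl)) (at-1 (odd (k + m + l) (m₁ k l m)))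
      (symb (disc (form a b c)) 2) (cong (λ χ → + 1 + χ) (sym (symb-2-split a m c (k * c) (ac₁ k c))))
    where open Two pp a b c prim
  go a b c prim (k , inj₁ refl) (m , inj₂ refl) (l , inj₂ refl) =
    count (at-∞ (even k refl)) (at-0 (odd l refl)) (at-1 (even (k + m + l + + 1) (m₂ k l m)))
      (symb (disc (form a b c)) 2) (cong (λ χ → + 1 + χ) (sym (symb-2-split a m c (k * c) (ac₁ k c))))
    where open Two pp a b c prim
  go a b c prim (k , inj₂ refl) (m , inj₂ refl) (l , inj₁ refl) =
    count (at-∞ (odd k refl)) (at-0 (even l refl)) (at-1 (even (k + m + l + + 1) (m₃ k l m)))
      (symb (disc (form a b c)) 2) (cong (λ χ → + 1 + χ) (sym (symb-2-split a m c (a * l) (ac₂ a l))))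
    where open Two pp a b c prim
  go a b c prim (k , inj₂ refl) (m , inj₂ refl) (l , inj₂ refl) =
    count (at-∞ (odd k refl)) (at-0 (odd l refl)) (at-1 (odd (k + m + l + + 1) (m₄ k l m)))
      (symb (disc (form a b c)) 2) (cong (λ χ → + 1 + χ) (sym (symb-2-inert a m c (+ 2 * k * l + k + l) (ac₃ k l))))
    where open Two pp a b c prim

anisotropic-length : ∀ p (pp : Prime p) F → Primitive F →
  + length (Orbits.anisotropic p pp F) ≡ + p - symb (disc F) p
anisotropic-length 0 pp F prim = contradiction pp ¬prime[0]
anisotropic-length 1 pp F prim = contradiction pp ¬prime[1]
anisotropic-length 2 pp (form a b c) prim = anisotropic-length-2 pp a b c prim
anisotropic-length p@(suc (suc (suc n))) pp F@(form a b c) prim = conclude zeroCount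
  where
  p∤2 : ¬ + p ∣ + 2
  p∤2 p∣2 = contradiction (ℕ.∣⇒≤ (∣⇒∣ᵤ p∣2)) (ℕ.<⇒≱ (ℕ.m≤m+n 3 n))
  open Isotropic p pp a b c prim
  open Odd p∤2
  conclude : ZeroCount → + length (Orbits.anisotropic p pp F) ≡ + p - symb (disc F) p
  conclude (zs , Z , inj₁ (len , p∣Δ)) = anisotropic-count {zs} {symb (disc F) p} Z
    (trans (cong +_ len) (cong (λ χ → + 1 + χ) (sym (symb-ramified n (disc F) p∣Δ))))
  conclude (zs , Z , inj₂ (inj₁ (len , p∤Δ , x , p∣x))) = anisotropic-count {zs} {symb (disc F) p} Z
    (trans (cong +_ len) (cong (λ χ → + 1 + χ) (sym (symb-residue n (disc F) (proj₁ h) p∤Δ (proj₁ (proj₂ h)) (proj₂ (proj₂ h))))))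
    where h = square-residue x p∣x
  conclude (zs , Z , inj₂ (inj₂ (len , p∤Δ , none))) = anisotropic-count {zs} {symb (disc F) p} Z
    (trans (cong +_ len) (cong (λ χ → + 1 + χ) (sym (symb-nonresidue n (disc F) p∤Δ (λ x _ → none (+ x))))))

-- Counting representations

sum-indicator : {A : Set} {P : A → Set} (P? : ∀ x → Dec (P x)) {f : A → ℕ} {k : ℕ} (xs : List A) →
  (∀ {x} → x ∈ xs → P x → f x ≡ k) → (∀ {x} → x ∈ xs → ¬ P x → f x ≡ 0) →
  sum (map f xs) ≡ length (filter P? xs) ℕ.* k
sum-indicator P? [] f≡k f≡0 = refl
sum-indicator P? (x ∷ xs) f≡k f≡0 with P? x
... | yes px = cong₂ ℕ._+_ (f≡k (here refl) px) (sum-indicator P? xs (f≡k ∘ there) (f≡0 ∘ there))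
... | no ¬px = cong₂ ℕ._+_ (f≡0 (here refl) ¬px) (sum-indicator P? xs (f≡k ∘ there) (f≡0 ∘ there))

dilate-cases : ∀ k f n {x} → (∀ m → n ≡ m ℕ.* k → x ≡ f m) → (¬ k ℕ.∣ n → x ≡ 0) → x ≡ dilate k f n
dilate-cases k f n hit miss with k ℕ.∣? n
... | yes (ℕ.divides m n≡mk) = hit m n≡mk
... | no k∤n                 = miss k∤n

P0-∣ : ∀ m f n → m ℕ.∣ n → P0 m f n ≡ f n
P0-∣ m f n m∣n = cong (λ t → if t then f n else 0) (dec-true (m ℕ.∣? n) m∣n)

P0-∤ : ∀ m f n → ¬ m ℕ.∣ n → P0 m f n ≡ 0
P0-∤ m f n m∤n = cong (λ t → if t then f n else 0) (dec-false (m ℕ.∣? n) m∤n)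

posDef-≋ : ∀ {P Q} → P ≋ Q → PosDef P → PosDef Q
posDef-≋ {P} (equiv M d eq) pd = subst PosDef eq (posDef-⟨⟩ P M {{subst NonZero (sym d) _}} pd)

module Counting (p : ℕ) (pp : Prime p) (F : Form) (pd : PosDef F) (prim : Primitive F) where
  open Modulo p pp
  open Lines p pp
  open Sublattice p pp
  open Orbits p pp F

  private instance
    +p≢0 : NonZero (+ p)
    +p≢0 = prime⇒nonZero pp

  L : Maybe ℕ → Form
  L i = F ⟨ emb p i ⟩

  det-emb≢0 : ∀ i → NonZero (det (emb p i))
  det-emb≢0 i = subst NonZero (sym (det-emb p i)) +p≢0

  posDef-L : ∀ i → PosDef (L i)
  posDef-L i = posDef-⟨⟩ F (emb p i) {{det-emb≢0 i}} pd

  sublattice-count : ∀ i {n k} {l : List (ℤ × ℤ)} → Unique l → (∀ v → v ∈ l ⇔ (eval F v ≡ + n)) →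
    IsRepCount (L i) n k → k ≡ length (filter (On? i) l)
  sublattice-count i {n} {l = l} ul l⇔ (xs , uxs , xs⇔ , refl) =
    injection-length (emb p i ⊙_) (⊙-injective (emb p i) {{det-emb≢0 i}}) uxs (Unique.filter⁺ (On? i) ul) into onto
    where
    into : ∀ u → u ∈ xs → emb p i ⊙ u ∈ filter (On? i) l
    into u u∈ = ∈-filter⁺ (On? i) (from (l⇔ (emb p i ⊙ u)) (trans (sym (eval-⟨⟩ F (emb p i) u)) (to (xs⇔ u) u∈))) (emb⇒on i u)
    onto : ∀ v → v ∈ filter (On? i) l → ∃ λ u → u ∈ xs × emb p i ⊙ u ≡ v
    onto v v∈ = u , from (xs⇔ u) (trans (eval-⟨⟩ F (emb p i) u) (trans (cong (eval F) eq) (to (l⇔ v) v∈l))) , eq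
      where
      v∈l = proj₁ (∈-filter⁻ (On? i) {xs = l} v∈)
      u = proj₁ (on⇒emb i v (proj₂ (∈-filter⁻ (On? i) {xs = l} v∈)))
      eq = proj₂ (on⇒emb i v (proj₂ (∈-filter⁻ (On? i) {xs = l} v∈)))

  lines-through : ℤ × ℤ → ℕ
  lines-through v = length (filter (λ i → On? i v) anisotropic)

  lines-through-multiple : ∀ v → Multiple v → lines-through v ≡ length anisotropic
  lines-through-multiple v mul =
    cong length (filter-all (λ i → On? i v) {anisotropic} (All.tabulate (λ {i} _ → multiple⇒on i v mul)))

  lines-through-isotropic : ∀ v → + p ∣ eval F v → ¬ Multiple v → lines-through v ≡ 0
  lines-through-isotropic v p∣ ¬mul =
    cong length (filter-none (λ i → On? i v) {anisotropic} (All.tabulate (λ {i} i∈ on →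
      ¬mul (on-anisotropic F i v on (proj₂ (∈-filter⁻ anisotropic? {xs = lines p} i∈)) p∣))))

  lines-through-anisotropic : ∀ v → ¬ + p ∣ eval F v → lines-through v ≡ 1
  lines-through-anisotropic v p∤ = unique-⇔⇒length≡
    (Unique.filter⁺ (λ i → On? i v) (Unique.filter⁺ anisotropic? (lines-unique p))) ([] ∷ []) λ i → mk⇔ (single i) (λ { (here refl) → found })
    where
    ¬mul : ¬ Multiple v
    ¬mul mul = p∤ (multiple⇒∣eval v mul)
    j = proj₁ (line v ¬mul)
    j∈ = proj₁ (proj₂ (line v ¬mul))
    on-j = proj₂ (proj₂ (line v ¬mul))
    found : j ∈ filter (λ i → On? i v) anisotropic
    found = ∈-filter⁺ (λ i → On? i v) (∈-filter⁺ anisotropic? j∈ (λ p∣ → p∤ (on-zero F j v on-j p∣))) on-j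
    single : ∀ i → i ∈ filter (λ i → On? i v) anisotropic → i ∈ j ∷ []
    single i i∈ = here (line-unique v (proj₁ (∈-filter⁻ anisotropic? {xs = lines p} (proj₁ i∈′))) j∈ ¬mul (proj₂ i∈′) on-j)
      where i∈′ = ∈-filter⁻ (λ i → On? i v) {xs = anisotropic} i∈

  module _ (r : Form → ℕ → ℕ) (rc : ∀ Q → PosDef Q → ∀ n → IsRepCount Q n (r Q n)) (n : ℕ) where

    private
      l = proj₁ (rc F pd n)
      ul = proj₁ (proj₂ (rc F pd n))
      l⇔ = proj₁ (proj₂ (proj₂ (rc F pd n)))
      l-length = proj₂ (proj₂ (proj₂ (rc F pd n)))

    sum-sublattices : sum (map (λ i → r (L i) n) anisotropic) ≡ sum (map lines-through l)
    sum-sublattices = trans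
      (sum-map-cong∈ anisotropic (λ {i} _ → sublattice-count i ul l⇔ (rc (L i) (posDef-L i) n)))
      (double-count On? anisotropic l)

    -- As F(pu) = p²F(u), multiplication by p matches the vectors of value m with the vectors of pℤ²
    -- of value mp².
    multiples-count : length (filter Multiple? l) ≡ dilate (p ℕ.* p) (r F) n
    multiples-count = dilate-cases (p ℕ.* p) (r F) n hit miss
      where
      p²-pos : ∀ m → + p * + p * + m ≡ + (m ℕ.* (p ℕ.* p))
      p²-pos m = trans (ℤ.*-comm (+ p * + p) (+ m)) (trans (cong (+ m *_) (sym (ℤ.pos-* p p))) (sym (ℤ.pos-* m (p ℕ.* p))))
      hit : ∀ m → n ≡ m ℕ.* (p ℕ.* p) → length (filter Multiple? l) ≡ r F m
      hit m n≡ = sym (trans (sym (proj₂ (proj₂ (proj₂ (rc F pd m)))))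
        (injection-length (scalar (+ p) ⊙_) (⊙-injective (scalar (+ p)) {{det≢0}}) (proj₁ (proj₂ (rc F pd m)))
          (Unique.filter⁺ Multiple? ul) into onto))
        where
        xs = proj₁ (rc F pd m)
        xs⇔ = proj₁ (proj₂ (proj₂ (rc F pd m)))
        det≡ : ∀ p → p * p ≡ p * p - + 0 * + 0
        det≡ = solve-∀
        det≢0 : NonZero (det (scalar (+ p)))
        det≢0 = subst NonZero (det≡ (+ p)) (ℤ.i*j≢0 (+ p) (+ p))
        into : ∀ u → u ∈ xs → scalar (+ p) ⊙ u ∈ filter Multiple? l
        into u u∈ = ∈-filter⁺ Multiple? (from (l⇔ (scalar (+ p) ⊙ u))
          (trans (eval-scalar F (+ p) u) (trans (cong (+ p * + p *_) (to (xs⇔ u) u∈)) (trans (p²-pos m) (cong +_ (sym n≡))))))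
          (scalar⇒multiple u)
        onto : ∀ v → v ∈ filter Multiple? l → ∃ λ u → u ∈ xs × scalar (+ p) ⊙ u ≡ v
        onto v v∈ = u , from (xs⇔ u) (ℤ.*-cancelˡ-≡ (+ p * + p) (eval F u) (+ m) {{ℤ.i*j≢0 (+ p) (+ p)}}
            (trans (sym (eval-scalar F (+ p) u)) (trans (cong (eval F) eq) (trans (to (l⇔ v) (proj₁ v∈′)) (trans (cong +_ n≡) (sym (p²-pos m))))))) , eq
          where
          v∈′ = ∈-filter⁻ Multiple? {xs = l} v∈
          u = proj₁ (multiple⇒scalar v (proj₂ v∈′))
          eq = proj₂ (multiple⇒scalar v (proj₂ v∈′))
      miss : ¬ p ℕ.* p ℕ.∣ n → length (filter Multiple? l) ≡ 0
      miss p²∤n = cong length (filter-none Multiple? {l} (All.tabulate λ {v} v∈ mul →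
        p²∤n (∣⇒∣ᵤ {+ (p ℕ.* p)} {+ n} (p²∣ v (to (l⇔ v) v∈) (multiple⇒scalar v mul)))))
        where
        p²∣ : ∀ v → eval F v ≡ + n → (∃ λ u → scalar (+ p) ⊙ u ≡ v) → + (p ℕ.* p) ∣ + n
        p²∣ v Fv≡n (u , eq) = divides (eval F u) (trans (sym Fv≡n) (trans (cong (eval F) (sym eq))
          (trans (eval-scalar F (+ p) u) (trans (ℤ.*-comm (+ p * + p) (eval F u)) (cong (eval F u *_) (sym (ℤ.pos-* p p)))))))

    -- For p ∤ n each vector lies on one anisotropic line, and both `dilate` and `P0` give 0. For p
    -- ∣ n only vectors of pℤ² count, each on all p - χ anisotropic lines, and `r F n` cancels
    -- against `P0`.
    sum-lines-through : + sum (map lines-through l)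
      ≡ (+ p - symb (disc F) p) * + dilate (p ℕ.* p) (r F) n + + r F n - + P0 p (r F) n
    sum-lines-through = cases (p ℕ.∣? n)
      where
      open ≡-Reasoning
      D = dilate (p ℕ.* p) (r F) n
      χ = symb (disc F) p
      R = r F n
      e₁ : ∀ x R → R ≡ x * + 0 + R - + 0
      e₁ = solve-∀
      e₂ : ∀ D x R → D * x ≡ x * D + R - R
      e₂ = solve-∀
      cases : Dec (p ℕ.∣ n) → + sum (map lines-through l) ≡ (+ p - χ) * + D + + R - + P0 p (r F) n
      cases (no p∤n) = begin
        + sum (map lines-through l)            ≡⟨ cong +_ (sum-map-const l (λ {v} v∈ → lines-through-anisotropic v
                                                    (λ p∣ → p∤n (∣⇒∣ᵤ {+ p} {+ n} (∣-resp-≡ (to (l⇔ v) v∈) p∣))))) ⟩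
        + (length l ℕ.* 1)                     ≡⟨ cong +_ (trans (ℕ.*-identityʳ (length l)) l-length) ⟩
        + R                                    ≡⟨ e₁ (+ p - χ) (+ R) ⟩
        (+ p - χ) * + 0 + + R - + 0            ≡⟨ cong₂ (λ s t → (+ p - χ) * + s + + R - + t)
                                                    (dilate-cases (p ℕ.* p) (r F) n (λ m n≡ → contradiction (p∣n m n≡) p∤n) (λ _ → refl))
                                                    (sym (P0-∤ p (r F) n p∤n)) ⟩
        (+ p - χ) * + D + + R - + P0 p (r F) n ∎
        where
        p∣n : ∀ m → n ≡ m ℕ.* (p ℕ.* p) → p ℕ.∣ n
        p∣n m n≡ = ℕ.divides (m ℕ.* p) (trans n≡ (sym (ℕ.*-assoc m p p)))
      cases (yes p∣n) = begin
        + sum (map lines-through l)            ≡⟨ cong +_ (sum-indicator Multiple? l (λ {v} _ → lines-through-multiple v)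
                                                    (λ {v} v∈ → lines-through-isotropic v (∣-resp-≡ (sym (to (l⇔ v) v∈)) (∣ᵤ⇒∣ {+ p} {+ n} p∣n)))) ⟩
        + (length (filter Multiple? l) ℕ.* length anisotropic) ≡⟨ cong (λ s → + (s ℕ.* length anisotropic)) multiples-count ⟩
        + (D ℕ.* length anisotropic)           ≡⟨ ℤ.pos-* D (length anisotropic) ⟩
        + D * + length anisotropic             ≡⟨ cong (+ D *_) (anisotropic-length p pp F prim) ⟩
        + D * (+ p - χ)                        ≡⟨ e₂ (+ D) (+ p - χ) (+ R) ⟩
        (+ p - χ) * + D + + R - + R            ≡⟨ cong (λ t → (+ p - χ) * + D + + R - + t) (P0-∣ p (r F) n p∣n) ⟨
        (+ p - χ) * + D + + R - + P0 p (r F) n ∎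

    module _ (S : List Form) (reps : IsPsiReps F p S) where

      private
        sound = proj₁ reps
        cover = proj₁ (proj₂ reps)
        apart = proj₂ (proj₂ reps)

      psi-line : ∀ {Q} → Q ∈ psiList F p → Primitive Q → ∃ λ i → Q ≡ L i × ¬ + p ∣ eval F (pt i)
      psi-line {Q} Q∈ primQ = found (∈-map⁻ L (subst (Q ∈_) (psiList-emb F p) Q∈))
        where
        found : (∃ λ i → i ∈ lines p × Q ≡ L i) → ∃ λ i → Q ≡ L i × ¬ + p ∣ eval F (pt i)
        found (i , _ , Q≡) = i , Q≡ , primitive⇒anisotropic F i (subst Primitive Q≡ primQ)

      -- The fibre of a representative consists of the lines whose restriction is equivalent to it,
      -- which is an orbit of w lines. Representatives are pairwise inequivalent, so no line belongs
      -- to two of them.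
      classes-sum : wOf (disc F) ℕ.* sum (map (λ Q → r Q n) S) ≡ sum (map (λ i → r (L i) n) anisotropic)
      classes-sum = sum-over-fibres (λ Q i → Q ≋ L i) anisotropic S (Unique.filter⁺ anisotropic? (lines-unique p))
          (λ Q∈ → fibre (sound Q∈))
          (AllPairs.map (λ ¬Q~R _ Q≋ R≋ → ¬Q~R (≋⇒~ (≋-trans Q≋ (≋-sym R≋)))) apart)
          covered
          -- A representative is any form of its class; it is positive definite because the
          -- equivalent restriction is.
          (λ {Q} {i} _ _ Q≋ → rep-count-≋ Q≋ (rc Q (posDef-≋ (≋-sym Q≋) (posDef-L i)) n) (rc (L i) (posDef-L i) n))
        where
        fibre : ∀ {Q} → (Σ Form λ Q′ → (Q′ ∈ psiList F p) × Primitive Q′ × (Q ~ Q′)) →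
                Fibre (λ Q i → Q ≋ L i) anisotropic Q (wOf (disc F))
        fibre {Q} (Q′ , Q′∈ , primQ′ , Q~Q′) = via (psi-line Q′∈ primQ′)
          where
          via : (∃ λ i → Q′ ≡ L i × ¬ + p ∣ eval F (pt i)) → Fibre (λ Q i → Q ≋ L i) anisotropic Q (wOf (disc F))
          via (i , Q′≡ , p∤) = convert (orbit prim {{a≢0}} (units-of F (proj₂ pd)) i p∤)
            where
            a≢0 : NonZero (Form.a F)
            a≢0 = ℤ.>-nonZero (proj₁ pd)
            Q≋ : Q ≋ L i
            Q≋ = subst (Q ≋_) Q′≡ (~⇒≋ Q~Q′)
            convert : (Σ (List (Maybe ℕ)) λ ks → Unique ks ×
              (∀ j → j ∈ ks ⇔ (j ∈ anisotropic × L j ≋ L i)) × length ks ≡ wOf (disc F)) →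
              Fibre (λ Q i → Q ≋ L i) anisotropic Q (wOf (disc F))
            convert (ks , uks , ks⇔ , len) = ks , uks , (λ j → mk⇔
              (λ j∈ → proj₁ (to (ks⇔ j) j∈) , ≋-trans Q≋ (≋-sym (proj₂ (to (ks⇔ j) j∈))))
              (λ (j∈ , Q≋Lj) → from (ks⇔ j) (j∈ , ≋-trans (≋-sym Q≋Lj) Q≋))) , len
        covered : ∀ {i} → i ∈ anisotropic → Any (_≋ L i) S
        covered {i} i∈ = place (cover (subst (L i ∈_) (sym (psiList-emb F p)) (∈-map⁺ L (proj₁ i∈′)))
                                      (anisotropic⇒primitive F i prim (proj₂ i∈′)))
          where
          i∈′ = ∈-filter⁻ anisotropic? {xs = lines p} i∈
          place : (Σ Form λ Q → (Q ∈ S) × (Q ~ L i)) → Any (_≋ L i) S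
          place (Q , Q∈ , Q~) = lose Q∈ (~⇒≋ Q~)

theorem5p1 : (F : Form) → PosDef F → Primitive F →
    (p : ℕ) → Prime p →
    (S : List Form) → IsPsiReps F p S →
    (r : Form → ℕ → ℕ) → (∀ Q → PosDef Q → ∀ n → IsRepCount Q n (r Q n)) →
    ∀ n →
    + wOf (disc F) * + sum (map (λ Q → r Q n) S)
    ≡ (+ p - symb (disc F) p) * + dilate (p ℕ.* p) (r F) n
    + + r F n - + P0 p (r F) n
theorem5p1 F pd prim p pp S reps r rc n =
  trans (sym (ℤ.pos-* (wOf (disc F)) (sum (map (λ Q → r Q n) S))))
    (trans (cong +_ (trans (classes-sum r rc n S reps) (sum-sublattices r rc n))) (sum-lines-through r rc n))
  where open Counting p pp F pd prim
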